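{- For every positive integer $u\equiv 1,3\pmod 6$ there exist a GLS*$(1,3;2,(3,\{3\},\{3\},\{5\}),3u+2)$ and a GLS$(1,3;2,(3,\{3\},\{3\},\{3\}),3u+2)$.
   Context: An S$(\lambda;2,K,v)$ is a pair $(X,\mathcal{B})$, $|X|=v$, $\mathcal{B}$ a multiset of subsets (blocks) of $X$ with sizes in $K$, each 2-subset of $X$ in exactly $\lambda$ blocks. An S$(3,K,v)$ is a pair $(X,\mathcal{B})$ with $\mathcal{B}$ a set of subsets of sizes in $K$, each 3-subset in exactly one block. An LS$(1,\lambda;2,(3,K),v)$ is a collection $(X,\mathcal{B}_r)_{r\in R}$ of S$(\lambda;2,K,v)$ on a common $X$ such that $(X,\bigcup_r\mathcal{B}_r)$ (ordinary union) is an S$(3,K,v)$ and each block $B$ of that union occurs exactly $|B|-2$ times in the multiset $\{B: B\in\mathcal{B}_r, r\in R\}$; it is an LS* if moreover each $B\in\mathcal{B}_r$ with $|B|\ge4$ occurs exactly $\lambda$ times in $\mathcal{B}_r$. An S$(\lambda;2,(K_0,K_1,K_2),v)$ is a quadruple $(S,\infty_1,\infty_2,\mathcal{B})$ with $|S|=v-2$, $\infty_1\ne\infty_2$, $\infty_1,\infty_2\notin S$, such that $(S\cup\{\infty_1,\infty_2\},\mathcal{B})$ is an S$(\lambda;2,K_0\cup K_1\cup K_2,v)$ and $|B|\in K_i$ for each block $B$ with $|B\cap\{\infty_1,\infty_2\}|=i$. An LS$(1,\lambda;2,(3,K_0,K_1,K_2),v)$ is a collection $(S,\infty_1,\infty_2,\mathcal{B}_r)_{r\in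 R}$ of such designs with $(S\cup\{\infty_1,\infty_2\},\mathcal{B}_r)_{r\in R}$ an LS$(1,\lambda;2,(3,K_0\cup K_1\cup K_2),v)$ (LS* analogously). A good design GS$(\lambda;2,(K_0,\{3\},K_2),v)$ is a 5-tuple $(S,\infty_1,\infty_2,\mathcal{B},D)$ where $(S,\infty_1,\infty_2,\mathcal{B})$ is an S$(\lambda;2,(K_0,\{3\},K_2),v)$ and $D$ is an Eulerian digraph on $S$ (every vertex has equal in-degree and out-degree) whose underlying undirected graph has edge set $\{\{x,y\}: x,y\in S, \{\infty_i,x,y\}\in\mathcal{B}, i\in\{1,2\}\}$. A GLS$(1,\lambda;2,(3,K_0,\{3\},K_2),v)$ is a collection $(S,\infty_1,\infty_2,\mathcal{B}_r,D_r)_{r\in R}$ of such GS where $(S,\infty_1,\infty_2,\mathcal{B}_r)_{r\in R}$ is an LS$(1,\lambda;2,(3,K_0,\{3\},K_2),v)$ and every ordered pair $(x,y)$ of distinct elements of $S$ not contained in any block $B$ with $\{\infty_1,\infty_2\}\subset B$ is an arc of exactly one $D_r$. A GLS* is a GLS whose underlying LS is an LS*. -}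

module Defs where

open import Data.Nat using (ℕ; zero; suc; _+_; _∸_; _≤_)
open import Data.Bool using (Bool; true; false)
import Data.Bool.Properties as BoolP
open import Data.Fin using (Fin) renaming (zero to fzero; suc to fsuc)
open import Data.Fin.Subset using (Subset; _∈_; ∣_∣; ⁅_⁆; _∪_)
open import Data.Fin.Subset.Properties using (_∈?_)
open import Data.Vec using (tabulate)
open import Data.Vec.Properties using (≡-dec)
open import Data.List using (List; length; filter; map)
open import Data.Nat.ListAction using (sum)
open import Data.List.Membership.Propositional renaming (_∈_ to _∈ₗ_)
open import Data.Product using (_×_; _,_; ∃; Σ)
open import Data.Sum using (_⊎_)
open import Relation.Binary.PropositionalEquality using (_≡_; _≢_)
open import Relation.Nullary using (Dec)
open import Relation.Nullary.Decidable using (_×-dec_)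
open import Function.Bundles using (_⇔_)

-- Basic conventions
--  * The point set X has v = 2 + n elements: X = Fin (2 + n).
--  * ∞₁ = 0, ∞₂ = 1, and S = {2, …, n+1}, embedded by  pt : Fin n → X.
--  * A block is a subset of X (Data.Fin.Subset); a multiset of blocks is a
--    List of blocks; a block-size set K is a predicate on ℕ.

Block : ℕ → Set
Block v = Subset v

_≟B_ : ∀ {v} (A B : Block v) → Dec (A ≡ B)
_≟B_ = ≡-dec BoolP._≟_

mult : ∀ {v} → Block v → List (Block v) → ℕ
mult B Bs = length (filter (λ C → C ≟B B) Bs)

pairCount : ∀ {v} → Fin v → Fin v → List (Block v) → ℕ
pairCount x y Bs = length (filter (λ C → (x ∈? C) ×-dec (y ∈? C)) Bs)

IsPairDesign : ∀ {v} → ℕ → (ℕ → Set) → List (Block v) → Set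
IsPairDesign {v} λ' K Bs =
  (∀ B → B ∈ₗ Bs → K ∣ B ∣) ×
  (∀ (x y : Fin v) → x ≢ y → pairCount x y Bs ≡ λ')

InUnion : ∀ {v} → List (List (Block v)) → Block v → Set
InUnion Bss B = ∃ λ Bs → Bs ∈ₗ Bss × B ∈ₗ Bs

IsLS : ∀ {v} → ℕ → (ℕ → Set) → List (List (Block v)) → Set
IsLS {v} λ' K Bss =
  (∀ Bs → Bs ∈ₗ Bss → IsPairDesign λ' K Bs) ×
  ((∀ (x y z : Fin v) → x ≢ y → x ≢ z → y ≢ z →
     ∃ λ B → (InUnion Bss B × x ∈ B × y ∈ B × z ∈ B) ×
       (∀ B' → InUnion Bss B' → x ∈ B' → y ∈ B' → z ∈ B' → B' ≡ B)) ×
   (∀ B → InUnion Bss B → sum (map (mult B) Bss) ≡ ∣ B ∣ ∸ 2))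

IsLS* : ∀ {v} → ℕ → (ℕ → Set) → List (List (Block v)) → Set
IsLS* λ' K Bss =
  IsLS λ' K Bss ×
  (∀ Bs → Bs ∈ₗ Bss → ∀ B → B ∈ₗ Bs → 4 ≤ ∣ B ∣ → mult B Bs ≡ λ')

∞₁ ∞₂ : ∀ {n} → Fin (2 + n)
∞₁ = fzero
∞₂ = fsuc fzero

pt : ∀ {n} → Fin n → Fin (2 + n)
pt x = fsuc (fsuc x)

numInf : ∀ {n} → Block (2 + n) → ℕ
numInf B = ind (∞₁ ∈? B) + ind (∞₂ ∈? B)
  where
  ind : ∀ {P : Set} → Dec P → ℕ
  ind (Relation.Nullary.yes _) = 1
  ind (Relation.Nullary.no _)  = 0

KAt : (K₀ K₁ K₂ : ℕ → Set) → ℕ → ℕ → Set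
KAt K₀ K₁ K₂ zero k = K₀ k
KAt K₀ K₁ K₂ (suc zero) k = K₁ k
KAt K₀ K₁ K₂ (suc (suc _)) k = K₂ k

Union3 : (K₀ K₁ K₂ : ℕ → Set) → ℕ → Set
Union3 K₀ K₁ K₂ k = K₀ k ⊎ K₁ k ⊎ K₂ k

IsTriDesign : ∀ {n} → ℕ → (K₀ K₁ K₂ : ℕ → Set) → List (Block (2 + n)) → Set
IsTriDesign λ' K₀ K₁ K₂ Bs =
  IsPairDesign λ' (Union3 K₀ K₁ K₂) Bs ×
  (∀ B → B ∈ₗ Bs → KAt K₀ K₁ K₂ (numInf B) ∣ B ∣)

Digraph : ℕ → Set
Digraph n = Fin n → Fin n → Bool

outdeg indeg : ∀ {n} → Digraph n → Fin n → ℕ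
outdeg D x = ∣ tabulate (λ y → D x y) ∣
indeg  D x = ∣ tabulate (λ y → D y x) ∣

IsEulerian : ∀ {n} → Digraph n → Set
IsEulerian {n} D = ∀ (x : Fin n) → indeg D x ≡ outdeg D x

record GDesign (n : ℕ) : Set where
  constructor gdesign
  field
    blocks : List (Block (2 + n))
    arcs   : Digraph n
open GDesign public

Three : ℕ → Set
Three k = k ≡ 3

IsGS : ∀ {n} → ℕ → (K₀ K₂ : ℕ → Set) → GDesign n → Set
IsGS {n} λ' K₀ K₂ d =
  IsTriDesign λ' K₀ Three K₂ (blocks d) ×
  IsEulerian (arcs d) ×
  (∀ (x y : Fin n) →
     (arcs d x y ≡ true ⊎ arcs d y x ≡ true) ⇔
     (∃ λ (i : Fin (2 + n)) → (i ≡ ∞₁ ⊎ i ≡ ∞₂) ×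
        (⁅ i ⁆ ∪ ⁅ pt x ⁆ ∪ ⁅ pt y ⁆) ∈ₗ blocks d))

arcCount : ∀ {n} → List (GDesign n) → Fin n → Fin n → ℕ
arcCount ds x y = length (filter (λ d → arcs d x y BoolP.≟ true) ds)

IsGLS : ∀ {n} → ℕ → (K₀ K₂ : ℕ → Set) → List (GDesign n) → Set
IsGLS {n} λ' K₀ K₂ ds =
  (∀ d → d ∈ₗ ds → IsGS λ' K₀ K₂ d) ×
  IsLS λ' (Union3 K₀ Three K₂) (map blocks ds) ×
  (∀ (x y : Fin n) → x ≢ y →
     (∀ B → InUnion (map blocks ds) B → ∞₁ ∈ B → ∞₂ ∈ B →
        pt x ∈ B → pt y ∈ B → Data.Empty.⊥) →
     arcCount ds x y ≡ 1)
  where import Data.Empty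

IsGLS* : ∀ {n} → ℕ → (K₀ K₂ : ℕ → Set) → List (GDesign n) → Set
IsGLS* λ' K₀ K₂ ds =
  IsGLS λ' K₀ K₂ ds ×
  IsLS* λ' (Union3 K₀ Three K₂) (map blocks ds)

{-# OPTIONS --safe #-}
module Submission where

-- Let S be the set of the 3u finite points.  Both large sets are read off a symmetric map
-- c : S³ → ℤ_u: the triple {x,y,z} lies in the c x y z -th design, the pair (x,y) is an arc of the
-- c x x y -th digraph, and c x x x is the index of the group of x (u groups of three points; with
-- ∞₁ and ∞₂ each group forms a "hole").  The triples {∞₁,x,y} and {∞₂,x,y} get the two colours
-- c x x y and c y y x in some order.  All requirements on pairs, on degrees and on arcs then say that
-- certain maps S → ℤ_u are three-to-one.  Keeping the ten triples inside each hole gives the GLS;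
-- replacing them by three copies of the hole gives the GLS*.
--
-- Such a colouring exists for every odd u.  If gcd(u,6) = 1, take S = ℤ_u × ℤ_3 and let c be a linear
-- form in the ℤ_u-coordinates whose weights depend on the ℤ_3-coordinates.  A colouring for u gives
-- one for 3u on three copies of S: triples inside a copy keep their colour, all others are coloured
-- by the sum of their ℤ_u-coordinates together with a rule for the copy.

open import Defs
open import Data.Nat using (ℕ; zero; suc; _+_; _*_; _∸_; _≤_; _<_; _≤ᵇ_; NonZero; z≤n; s≤s; >-nonZero)
import Data.Nat.Properties as ℕP
open import Data.Nat.DivMod using (_mod_; _%_; _/_; m≡m%n+[m/n]*n; m%n<n)
open import Data.Nat.Divisibility using (_∣_; _∣?_; divides; >⇒∤; ∣-trans; %-presˡ-∣; m∣m*n)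
open import Data.Nat.Coprimality using (Coprime; coprime-divisor)
open import Data.Nat.Primality using (prime?; prime⇒irreducible)
open import Data.Nat.Induction using (<-wellFounded)
open import Data.Nat.ListAction using (sum)
open import Data.Nat.Tactic.RingSolver using (solve-∀)
open import Data.Bool using (Bool; true; false; T; if_then_else_; not; _xor_)
import Data.Bool.Properties as BoolP
open import Data.Fin using (Fin; zero; suc; toℕ; fromℕ<; combine; remQuot; punchOut)
open import Data.Fin.Properties as FinP using (toℕ<n; toℕ-injective; fromℕ<-injective; all?; any?)
open import Data.Fin.Subset using (Subset; _∈_; _⊆_; _∪_; ⁅_⁆; ∣_∣)
open import Data.Fin.Subset.Properties
  using (_∈?_; _⊆?_; x∈p∪q⁻; x∈p∪q⁺; x∈⁅x⁆; x∈⁅y⁆⇒x≡y; ⊆-antisym; p⊂q⇒∣p∣<∣q∣)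
open import Data.Vec using (tabulate; []; _∷_; here; there)
open import Data.Vec.Properties using (lookup∘tabulate; []=⇒lookup; lookup⇒[]=)
open import Data.List using (List; []; _∷_; length; filter; map; allFin; _++_)
open import Data.List.Properties using (length-map; filter-none; filter-accept; filter-reject; map-∘)
open import Data.List.Membership.Propositional renaming (_∈_ to _∈ₗ_; _∉_ to _∉ₗ_)
open import Data.List.Membership.Propositional.Properties
  using (∈-map⁺; ∈-map⁻; ∈-++⁺ˡ; ∈-++⁺ʳ; ∈-filter⁺; ∈-filter⁻; ∈-allFin)
open import Data.List.Membership.Propositional.Properties.WithK using (unique∧set⇒bag)
open import Data.List.Relation.Unary.Any using (here; there)
open import Data.List.Relation.Unary.All as All using (All; []; _∷_)
open import Data.List.Relation.Unary.AllPairs using ([]; _∷_)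
open import Data.List.Relation.Unary.Unique.Propositional using (Unique)
open import Data.List.Relation.Unary.Unique.Propositional.Properties
  using (map⁺; ++⁺; filter⁺; allFin⁺; Unique[x∷xs]⇒x∉xs)
open import Data.List.Relation.Binary.Permutation.Propositional.Properties using (↭-length)
open import Data.List.Relation.Binary.BagAndSetEquality using (∼bag⇒↭)
open import Data.Product using (_×_; _,_; proj₁; proj₂; ∃; swap; uncurry) renaming (map to ×-map; map₁ to ×-map₁)
open import Data.Sum using (_⊎_; inj₁; inj₂) renaming (map to ⊎-map)
open import Data.Unit using (⊤)
open import Data.Empty using (⊥; ⊥-elim)
open import Function using (_∘_; _⇔_; mk⇔; Equivalence)
open import Induction.WellFounded using (Acc; acc)
open import Level using (0ℓ)
open import Relation.Nullary using (Dec; yes; no; ¬_; contradiction)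
open import Relation.Nullary.Decidable
  using (from-yes; from-no; does; ⌊_⌋; dec-true; ¬?; _×-dec_; _→-dec_)
open import Relation.Unary using (Pred; Decidable)
open import Relation.Binary.PropositionalEquality

-- Any two of the 3u + 2 points leave 3u third points, as many as S has, and λ = 3 asks that each of
-- the u colours be met by three of them. Repeated arguments make room for the infinite points:
-- `c x y` takes at `x` and `y` the two arc colours, which are those of the triples of x and y with
-- ∞₁ and ∞₂, and `c x x x` is the colour of {∞₁,∞₂,x}. The obstacle is the pair of an infinite
-- point with x. Together the colours `c x x y` and `c y y x` are six-to-one in y, but one of them
-- must go to ∞₁ and the other to ∞₂, symmetrically in x and y, so that both shares are
-- three-to-one. The linear form manages this by a match between the coefficients of out-arcs and
-- in-arcs up to a shift of levels, the tripling by orienting whole copies cyclically. A hole can be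
-- exchanged for a block because its points already fill the three-element fibres: a triple of its
-- colour with two points in the hole lies inside it. The weights need 2 and 3 to be units modulo u,
-- hence the other construction for multiples of 3; the sums used there need only 2 to be a unit.

open Equivalence using (to; from)

-- When |S| = 3|I|, such a ranking exists only if every fibre has exactly three elements.
ThreeToOne : {S I : Set} → (S → I) → Set
ThreeToOne {S} f = ∃ λ (rank : S → Fin 3) → ∀ {z z′} → f z ≡ f z′ → rank z ≡ rank z′ → z ≡ z′

-- `c-pair` controls the blocks through two finite points and, on the diagonal, the out-degrees;
-- `c-square` controls the in-degrees, `c-cube` the blocks through both infinite points, and
-- `w-point` those through an infinite and a finite point.
record Colouring (S I : Set) : Set where
  field
    c          : S → S → S → I
    c-sym₁₂    : ∀ x y z → c x y z ≡ c y x z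
    c-sym₂₃    : ∀ x y z → c x y z ≡ c x z y
    c-pair     : ∀ x y → ThreeToOne (c x y)
    c-square   : ∀ y → ThreeToOne (λ z → c z z y)
    c-cube     : ThreeToOne (λ z → c z z z)
    c-hole     : ∀ x y z → c x x x ≡ c y y y → c x x x ≡ c z z z → c x y z ≡ c x x x
    -- w false x y and w true x y are the colours of {∞₁,x,y} and {∞₂,x,y}.
    w          : Bool → S → S → I
    w-sym      : ∀ b x y → w b x y ≡ w b y x
    w-arcs     : ∀ x y → (w false x y ≡ c x x y × w true x y ≡ c y y x)
                       ⊎ (w false x y ≡ c y y x × w true x y ≡ c x x y)
    w-point    : ∀ b x → ThreeToOne (w b x)

-- Affine maps modulo u

module _ {u : ℕ} .{{_ : NonZero u}} where

  m%u≡n%u⇒u∣n∸m : ∀ m n → m % u ≡ n % u → u ∣ n ∸ m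
  m%u≡n%u⇒u∣n∸m m n eq = divides (n / u ∸ m / u) (begin
    n ∸ m                                       ≡⟨ cong₂ _∸_ (m≡m%n+[m/n]*n n u) (m≡m%n+[m/n]*n m u) ⟩
    (n % u + n / u * u) ∸ (m % u + m / u * u)   ≡⟨ cong (λ r → (n % u + n / u * u) ∸ (r + m / u * u)) eq ⟩
    (n % u + n / u * u) ∸ (n % u + m / u * u)   ≡⟨ ℕP.[m+n]∸[m+o]≡n∸o (n % u) _ _ ⟩
    n / u * u ∸ m / u * u                       ≡⟨ ℕP.*-distribʳ-∸ u (n / u) (m / u) ⟨
    (n / u ∸ m / u) * u                         ∎)
    where open ≡-Reasoning

  mod-injective : ∀ m n → m mod u ≡ n mod u → m % u ≡ n % u
  mod-injective m n = fromℕ<-injective _ _ (m%n<n m u) (m%n<n n u)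

  -- Truncated subtraction sees only one sign, so each inequality is proved separately: if `q`
  -- exceeded `p`, then `u` would divide `w` times the difference, hence the difference itself,
  -- which is positive and less than `u`.
  affine-injective : ∀ {w} → Coprime u w → ∀ a (x y : Fin u) →
                     (a + w * toℕ x) mod u ≡ (a + w * toℕ y) mod u → x ≡ y
  affine-injective {w} cop a x y eq = toℕ-injective (ℕP.≤-antisym (below y x (sym eq′)) (below x y eq′))
    where
    eq′ : (a + w * toℕ x) % u ≡ (a + w * toℕ y) % u
    eq′ = mod-injective (a + w * toℕ x) (a + w * toℕ y) eq
    below : ∀ (p q : Fin u) → (a + w * toℕ p) % u ≡ (a + w * toℕ q) % u → toℕ q ≤ toℕ p
    below p q e with toℕ q ∸ toℕ p in d≡
    ... | zero = ℕP.m∸n≡0⇒m≤n d≡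
    ... | suc d = contradiction u∣1+d (>⇒∤ (ℕP.≤-<-trans (subst (_≤ toℕ q) d≡ (ℕP.m∸n≤m (toℕ q) (toℕ p))) (toℕ<n q)))
      where
      open ≡-Reasoning
      u∣1+d : u ∣ suc d
      u∣1+d = coprime-divisor cop (subst (u ∣_) (begin
        (a + w * toℕ q) ∸ (a + w * toℕ p)  ≡⟨ ℕP.[m+n]∸[m+o]≡n∸o a _ _ ⟩
        w * toℕ q ∸ w * toℕ p              ≡⟨ ℕP.*-distribˡ-∸ w (toℕ q) (toℕ p) ⟨
        w * (toℕ q ∸ toℕ p)                ≡⟨ cong (w *_) d≡ ⟩
        w * suc d                          ∎) (m%u≡n%u⇒u∣n∸m (a + w * toℕ p) (a + w * toℕ q) e))

coprime-∣ : ∀ {u v w} → Coprime u v → w ∣ v → Coprime u w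
coprime-∣ cop w∣v (d∣u , d∣w) = cop (d∣u , ∣-trans d∣w w∣v)

-- Counting in lists and subsets

module _ {A : Set} where

  length-unique : ∀ {xs ys : List A} → Unique xs → Unique ys → (∀ z → z ∈ₗ xs ⇔ z ∈ₗ ys) → length xs ≡ length ys
  length-unique u v same = ↭-length (∼bag⇒↭ (unique∧set⇒bag u v (λ {z} → same z)))

  -- Pair counts, single multiplicities and arc counts all come down to this: exhibit a
  -- duplicate-free list of the expected members and compare memberships.
  length-filter-unique : ∀ {P : Pred A 0ℓ} (P? : Decidable P) {xs ys : List A} → Unique xs → Unique ys →
                         (∀ z → z ∈ₗ ys ⇔ (z ∈ₗ xs × P z)) → length (filter P? xs) ≡ length ys
  length-filter-unique P? {xs} u v same = length-unique (filter⁺ P? u) v λ z →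
    mk⇔ (λ z∈ → from (same z) (∈-filter⁻ P? z∈))
        (λ z∈ → let (z∈xs , pz) = to (same z) z∈ in ∈-filter⁺ P? z∈xs pz)

  -- Each block belongs to the design of one colour only, so its multiplicities over the family form
  -- a sum with a single nonzero term.
  sum-single : ∀ (f : A → ℕ) {x xs} → Unique xs → x ∈ₗ xs → (∀ y → y ≢ x → f y ≡ 0) → sum (map f xs) ≡ f x
  sum-single f {x} (ne ∷ un) (here refl) vanish = trans (cong (f x +_) (zeros _ ne)) (ℕP.+-identityʳ (f x))
    where
    zeros : ∀ ys → All (x ≢_) ys → sum (map f ys) ≡ 0
    zeros []       []       = refl
    zeros (y ∷ ys) (p ∷ ps) = cong₂ _+_ (vanish y (p ∘ sym)) (zeros ys ps)
  sum-single f {x} {y ∷ ys} un@(_ ∷ un′) (there x∈ys) vanish =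
    cong₂ _+_ (vanish y λ { refl → Unique[x∷xs]⇒x∉xs un x∈ys }) (sum-single f un′ x∈ys vanish)

  length-filter-map : ∀ {B : Set} {P : Pred B 0ℓ} (P? : Decidable P) (f : A → B) xs →
                      length (filter P? (map f xs)) ≡ length (filter (P? ∘ f) xs)
  length-filter-map P? f []       = refl
  length-filter-map P? f (x ∷ xs) with does (P? (f x))
  ... | true  = cong suc (length-filter-map P? f xs)
  ... | false = length-filter-map P? f xs

elements : ∀ {n} → Subset n → List (Fin n)
elements []          = []
elements (true ∷ p)  = zero ∷ map suc (elements p)
elements (false ∷ p) = map suc (elements p)

length-elements : ∀ {n} (p : Subset n) → length (elements p) ≡ ∣ p ∣
length-elements []          = refl
length-elements (true ∷ p)  = cong suc (trans (length-map suc (elements p)) (length-elements p))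
length-elements (false ∷ p) = trans (length-map suc (elements p)) (length-elements p)

elements-unique : ∀ {n} (p : Subset n) → Unique (elements p)
elements-unique []          = []
elements-unique (true ∷ p)  = All.tabulate (λ z∈ e → case-map (∈-map⁻ suc z∈) e) ∷ map⁺ FinP.suc-injective (elements-unique p)
  where
  case-map : ∀ {n} {xs : List (Fin n)} {z} → ∃ (λ y → y ∈ₗ xs × z ≡ suc y) → zero ≢ z
  case-map (_ , _ , refl) ()
elements-unique (false ∷ p) = map⁺ FinP.suc-injective (elements-unique p)

∈-elements⁺ : ∀ {n} {x : Fin n} {p} → x ∈ p → x ∈ₗ elements p
∈-elements⁺ {p = true  ∷ p} here      = here refl
∈-elements⁺ {p = true  ∷ p} (there q) = there (∈-map⁺ suc (∈-elements⁺ q))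
∈-elements⁺ {p = false ∷ p} (there q) = ∈-map⁺ suc (∈-elements⁺ q)

∈-elements⁻ : ∀ {n} {x : Fin n} p → x ∈ₗ elements p → x ∈ p
∈-elements⁻ (true  ∷ p) (here refl) = here
∈-elements⁻ (true  ∷ p) (there x∈) with _ , y∈ , refl ← ∈-map⁻ suc x∈ = there (∈-elements⁻ p y∈)
∈-elements⁻ (false ∷ p) x∈ with _ , y∈ , refl ← ∈-map⁻ suc x∈ = there (∈-elements⁻ p y∈)

∣∣-unique : ∀ {n} (p : Subset n) {xs} → Unique xs → (∀ x → x ∈ p ⇔ x ∈ₗ xs) → ∣ p ∣ ≡ length xs
∣∣-unique p un same = trans (sym (length-elements p)) (length-unique (elements-unique p) un λ x →
  mk⇔ (to (same x) ∘ ∈-elements⁻ p) (∈-elements⁺ ∘ from (same x)))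

⊆∧∣∣≡⇒≡ : ∀ {n} {p q : Subset n} → p ⊆ q → ∣ p ∣ ≡ ∣ q ∣ → p ≡ q
⊆∧∣∣≡⇒≡ {p = p} {q} p⊆q eq = ⊆-antisym p⊆q q⊆p
  where
  q⊆p : q ⊆ p
  q⊆p {x} x∈q with x ∈? p
  ... | yes x∈p = x∈p
  ... | no x∉p  = contradiction eq (ℕP.<⇒≢ (p⊂q⇒∣p∣<∣q∣ (p⊆q , x , x∈q , x∉p)))

module _ {n : ℕ} {P : Pred (Fin n) 0ℓ} (P? : Decidable P) where

  ∈-tabulate⁺ : ∀ {x} → P x → x ∈ tabulate (λ y → does (P? y))
  ∈-tabulate⁺ {x} px = lookup⇒[]= x _ (trans (lookup∘tabulate _ x) (dec-true (P? x) px))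

  ∈-tabulate⁻ : ∀ {x} → x ∈ tabulate (λ y → does (P? y)) → P x
  ∈-tabulate⁻ {x} x∈ with P? x | trans (sym (lookup∘tabulate (λ y → does (P? y)) x)) ([]=⇒lookup x∈)
  ... | yes px | _  = px
  ... | no _   | ()

opaque
  -- Filtering this list by a decidable property lists each block once, however many ordered triples
  -- of points describe it.
  subsets : ∀ n → List (Subset n)
  subsets zero    = [] ∷ []
  subsets (suc n) = map (true ∷_) (subsets n) ++ map (false ∷_) (subsets n)

  ∈-subsets : ∀ {n} (p : Subset n) → p ∈ₗ subsets n
  ∈-subsets []          = here refl
  ∈-subsets (true  ∷ p) = ∈-++⁺ˡ (∈-map⁺ _ (∈-subsets p))
  ∈-subsets (false ∷ p) = ∈-++⁺ʳ _ (∈-map⁺ _ (∈-subsets p))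

  subsets-unique : ∀ n → Unique (subsets n)
  subsets-unique zero    = [] ∷ []
  subsets-unique (suc n) = ++⁺ (map⁺ (λ { refl → refl }) (subsets-unique n)) (map⁺ (λ { refl → refl }) (subsets-unique n))
    λ (p∈ , p∈′) → disjoint (∈-map⁻ _ p∈) (∈-map⁻ _ p∈′)
    where
    disjoint : ∀ {p} → ∃ (λ q → q ∈ₗ subsets n × p ≡ true ∷ q) → ¬ ∃ (λ q → q ∈ₗ subsets n × p ≡ false ∷ q)
    disjoint (_ , _ , refl) (_ , _ , ())

-- Maps with three-element fibres

injective⇒surjective : ∀ {n} {f : Fin n → Fin n} → (∀ {x y} → f x ≡ f y → x ≡ y) → ∀ y → ∃ λ x → f x ≡ y
injective⇒surjective {suc n} {f} inj y with any? (λ x → f x FinP.≟ y)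
... | yes found = found
-- Punching out the missed value would inject `Fin (suc n)` into `Fin n`.
... | no none = contradiction (FinP.injective⇒≤ {f = λ x → punchOut (missed x)} (inj ∘ FinP.punchOut-injective (missed _) (missed _))) ℕP.1+n≰n
  where
  missed : ∀ x → y ≢ f x
  missed x eq = none (x , sym eq)

module ThreeToOneProperties {n u : ℕ} (n≡u*3 : n ≡ u * 3) where

  -- Colour and rank together form an injection between sets of the same size, hence a bijection.
  ranked : (f : Fin n → Fin u) (t : ThreeToOne f) → ∀ r i → ∃ λ z → f z ≡ r × proj₁ t z ≡ i
  ranked f (rank , inj) r i = surjective n≡u*3 r i
    where
    surjective : n ≡ u * 3 → ∀ r i → ∃ λ z → f z ≡ r × rank z ≡ i
    surjective refl r i with injective⇒surjective {f = λ z → combine (f z) (rank z)}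
      (λ {x} {y} e → inj (FinP.combine-injectiveˡ (f x) (rank x) (f y) (rank y) e)
                         (FinP.combine-injectiveʳ (f x) (rank x) (f y) (rank y) e)) (combine r i)
    ... | z , eq = z , FinP.combine-injectiveˡ (f z) (rank z) r i eq , FinP.combine-injectiveʳ (f z) (rank z) r i eq

  module _ {f : Fin n → Fin u} (t : ThreeToOne f) (r : Fin u) where

    fibre : List (Fin n)
    fibre = map (λ i → proj₁ (ranked f t r i)) (allFin 3)

    fibre-unique : Unique fibre
    fibre-unique = map⁺ (λ {i} {j} e → trans (sym (proj₂ (proj₂ (ranked f t r i))))
      (trans (cong (proj₁ t) e) (proj₂ (proj₂ (ranked f t r j))))) (allFin⁺ 3)

    ∈-fibre⁺ : ∀ {z} → f z ≡ r → z ∈ₗ fibre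
    ∈-fibre⁺ {z} fz≡r with ranked f t r (proj₁ t z) in eq
    ... | z′ , fz′≡r , same = subst (_∈ₗ fibre)
      (trans (cong proj₁ eq) (proj₂ t (trans fz′≡r (sym fz≡r)) same)) (∈-map⁺ (λ i → proj₁ (ranked f t r i)) (∈-allFin (proj₁ t z)))

    ∈-fibre⁻ : ∀ {z} → z ∈ₗ fibre → f z ≡ r
    ∈-fibre⁻ z∈ with i , _ , refl ← ∈-map⁻ (λ i → proj₁ (ranked f t r i)) z∈ = proj₁ (proj₂ (ranked f t r i))

  -- Both fibres have three elements, so the inclusion is an equality.
  fibre-⊇ : ∀ {f g : Fin n → Fin u} → ThreeToOne f → ThreeToOne g → ∀ r →
            (∀ z → g z ≡ r → f z ≡ r) → ∀ z → f z ≡ r → g z ≡ r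
  fibre-⊇ {f} {g} tf@(rank , inj) tg r g⇒f z fz≡r =
    let i , same = injective⇒surjective injective (rank z)
    in subst (λ p → g p ≡ r) (inj (trans (g⇒f _ (ga≡r i)) (sym fz≡r)) same) (ga≡r i)
    where
    a : Fin 3 → Fin n
    a i = proj₁ (ranked g tg r i)
    ga≡r : ∀ i → g (a i) ≡ r
    ga≡r i = proj₁ (proj₂ (ranked g tg r i))
    injective : ∀ {i j} → rank (a i) ≡ rank (a j) → i ≡ j
    injective {i} {j} e = trans (sym (proj₂ (proj₂ (ranked g tg r i))))
      (trans (cong (proj₁ tg) (inj (trans (g⇒f _ (ga≡r i)) (sym (g⇒f _ (ga≡r j)))) e))
             (proj₂ (proj₂ (ranked g tg r j))))

-- `ThreeToOne` asks only for an injectivity, so it pulls back along injective relabellings of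
-- points and colours.
colouring-map : ∀ {S S′ I I′} (e : S′ → S) → (∀ {x y} → e x ≡ e y → x ≡ y) →
          (r : I → I′) → (∀ {i j} → r i ≡ r j → i ≡ j) → Colouring S I → Colouring S′ I′
colouring-map e e-inj r r-inj base = record
  { c        = λ x y z → r (c (e x) (e y) (e z))
  ; c-sym₁₂  = λ x y z → cong r (c-sym₁₂ (e x) (e y) (e z))
  ; c-sym₂₃  = λ x y z → cong r (c-sym₂₃ (e x) (e y) (e z))
  ; c-pair   = λ x y → pull (c-pair (e x) (e y))
  ; c-square = λ y → pull (c-square (e y))
  ; c-cube   = pull c-cube
  ; c-hole   = λ x y z p q → cong r (c-hole (e x) (e y) (e z) (r-inj p) (r-inj q))
  ; w        = λ b x y → r (w b (e x) (e y))
  ; w-sym    = λ b x y → cong r (w-sym b (e x) (e y))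
  ; w-arcs   = λ x y → ⊎-map (×-map (cong r) (cong r)) (×-map (cong r) (cong r)) (w-arcs (e x) (e y))
  ; w-point  = λ b x → pull (w-point b (e x))
  }
  where
  open Colouring base
  pull : ∀ {f} → ThreeToOne f → ThreeToOne (λ z → r (f (e z)))
  pull (rank , inj) = rank ∘ e , λ p q → e-inj (inj (r-inj p) q)

-- Colourings for u coprime to 6

next : Fin 3 → Fin 3
next zero             = suc zero
next (suc zero)       = suc (suc zero)
next (suc (suc zero)) = zero

next-injective : ∀ i j → next i ≡ next j → i ≡ j
next-injective = from-yes (all? λ i → all? λ j → (next i FinP.≟ next j) →-dec (i FinP.≟ j))

opaque
  -- The weights of any three levels sum to 12, so c is constantly 12x on the group of x.  The choice of
  -- 2, 8, 3 and 6 makes weight-out≡in₁ and weight-out≡in₂ true: seen from a point of level i, the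
  -- colours of the arcs to level next j are those of the arcs from level j, which balances ∞₁ against ∞₂.
  weight : Fin 3 → Fin 3 → Fin 3 → ℕ
  weight i j k =
    if j == k then (if i == j then 4 else if i == next j then 8 else 6)
    else if i == j then (if k == next i then 2 else 3)
    else if i == k then (if j == next i then 2 else 3)
    else 4
    where
    _==_ : Fin 3 → Fin 3 → Bool
    p == q = ⌊ p FinP.≟ q ⌋

  weight-sym : ∀ i j k → weight i j k ≡ weight i k j
  weight-sym = from-yes (all? λ i → all? λ j → all? λ k → weight i j k ℕP.≟ weight i k j)

  -- The weights 2, 3, 4, 6, 8, and the doubled ones that arise from a repeated point, have no prime
  -- factors but 2 and 3, so they are units modulo `u`.
  weight∣24 : ∀ i j k → weight i j k ∣ 24
  weight∣24 = from-yes (all? λ i → all? λ j → all? λ k → weight i j k ∣? 24)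

  2*weight∣24 : ∀ i j → 2 * weight i i j ∣ 24
  2*weight∣24 = from-yes (all? λ i → all? λ j → 2 * weight i i j ∣? 24)

  weight-sum : ∀ i j k → weight i j k + weight j i k + weight k i j ≡ 12
  weight-sum = from-yes (all? λ i → all? λ j → all? λ k → (weight i j k + weight j i k + weight k i j) ℕP.≟ 12)

  weight-out≡in₁ : ∀ i j → 2 * weight i i (next j) ≡ weight i j j
  weight-out≡in₁ = from-yes (all? λ i → all? λ j → (2 * weight i i (next j)) ℕP.≟ weight i j j)

  weight-out≡in₂ : ∀ i j → weight (next j) i i ≡ 2 * weight j j i
  weight-out≡in₂ = from-yes (all? λ i → all? λ j → weight (next j) i i ℕP.≟ (2 * weight j j i))

module Affine (u : ℕ) .{{_ : NonZero u}} (coprime : Coprime u 24) where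

  S : Set
  S = Fin u × Fin 3

  c : S → S → S → Fin u
  c (x , i) (y , j) (z , k) =
    (weight i j k * toℕ x + weight j i k * toℕ y + weight k i j * toℕ z) mod u

  c-sym₁₂ : ∀ x y z → c x y z ≡ c y x z
  c-sym₁₂ (x , i) (y , j) (z , k) rewrite weight-sym k j i =
    cong (λ s → (s + weight k i j * toℕ z) mod u) (ℕP.+-comm (weight i j k * toℕ x) _)

  c-sym₂₃ : ∀ x y z → c x y z ≡ c x z y
  c-sym₂₃ (x , i) (y , j) (z , k)
    rewrite weight-sym i k j | weight-sym k i j =
    cong (_mod u) (ring (weight i j k * toℕ x) (weight j i k * toℕ y) (weight k j i * toℕ z))
    where
    ring : ∀ p q r → p + q + r ≡ p + r + q
    ring = solve-∀

  c-out : ∀ x i z k → c (x , i) (x , i) (z , k) ≡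
          (2 * weight i i k * toℕ x + weight k i i * toℕ z) mod u
  c-out x i z k = cong (_mod u) (ring (weight i i k) (weight k i i) (toℕ x) (toℕ z))
    where
    ring : ∀ p q r s → p * r + p * r + q * s ≡ 2 * p * r + q * s
    ring = solve-∀

  c-in : ∀ z k x i → c (z , k) (z , k) (x , i) ≡
          (weight i k k * toℕ x + 2 * weight k k i * toℕ z) mod u
  c-in z k x i = trans (c-out z k x i) (cong (_mod u) (ℕP.+-comm (2 * weight k k i * toℕ z) _))

  c-fibre : ∀ x i j k → c (x , i) (x , j) (x , k) ≡ (0 + 12 * toℕ x) mod u
  c-fibre x i j k = cong (_mod u) (trans (ring (weight i j k) (weight j i k) (weight k i j) (toℕ x))
                                     (cong (_* toℕ x) (weight-sum i j k)))
    where
    ring : ∀ p q r s → p * s + q * s + r * s ≡ (p + q + r) * s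
    ring = solve-∀

  12*-injective : ∀ x y → (0 + 12 * toℕ x) mod u ≡ (0 + 12 * toℕ y) mod u → x ≡ y
  12*-injective x y = affine-injective {w = 12} (coprime-∣ coprime (divides 2 refl)) 0 x y

  c-pair : ∀ x y → ThreeToOne (c x y)
  c-pair (x , i) (y , j) = proj₂ , λ
    { {z , k} {z′ , .k} eq refl → cong (_, k) (affine-injective (coprime-∣ coprime (weight∣24 k i j)) _ z z′ eq) }

  in-injective : ∀ x i k z z′ → c (z , k) (z , k) (x , i) ≡ c (z′ , k) (z′ , k) (x , i) → z ≡ z′
  in-injective x i k z z′ eq = affine-injective (coprime-∣ coprime (2*weight∣24 k i)) _ z z′
    (trans (sym (c-in z k x i)) (trans eq (c-in z′ k x i)))

  c-square : ∀ y → ThreeToOne (λ z → c z z y)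
  c-square (x , i) = proj₂ , λ
    { {z , k} {z′ , .k} eq refl → cong (_, k) (in-injective x i k z z′ eq) }

  -- On a repeated point `c` is 12 times the first coordinate, and 12 is a unit: the groups are the
  -- sets of points with a common first coordinate.
  c-cube-injective : ∀ x i y j → c (x , i) (x , i) (x , i) ≡ c (y , j) (y , j) (y , j) → x ≡ y
  c-cube-injective x i y j eq = 12*-injective x y (trans (sym (c-fibre x i i i)) (trans eq (c-fibre y j j j)))

  c-cube : ThreeToOne (λ z → c z z z)
  c-cube = proj₂ , λ
    { {z , k} {z′ , .k} eq refl → cong (_, k) (c-cube-injective z k z′ k eq) }

  c-hole : ∀ x y z → c x x x ≡ c y y y → c x x x ≡ c z z z → c x y z ≡ c x x x
  c-hole (x , i) (y , j) (z , k) e e′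
    with refl ← c-cube-injective x i y j e | refl ← c-cube-injective x i z k e′ =
    trans (c-fibre x i j k) (sym (c-fibre x i i i))

  -- The order of the representatives 0, ..., u - 1 orients every pair with different first
  -- coordinates, and `b` reverses it, so that each infinite point receives the colour that the
  -- other does not.
  out : Bool → Fin u → Fin u → Bool
  out b x z = (toℕ x ≤ᵇ toℕ z) xor b

  w : Bool → S → S → Fin u
  w b x y = if out b (proj₁ x) (proj₁ y) then c x x y else c y y x

  -- When the first coordinates agree, the order prefers neither direction; symmetry of `w` survives
  -- because both arc colours equal the index of the common group.
  w-tie : ∀ b x i j → w b (x , i) (x , j) ≡ (0 + 12 * toℕ x) mod u
  w-tie b x i j with out b x x
  ... | true  = c-fibre x i i j
  ... | false = c-fibre x j j i

  out-flip : ∀ b x y → x ≢ y → out b y x ≡ not (out b x y)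
  out-flip b x y x≢y with toℕ x ≤ᵇ toℕ y in p | toℕ y ≤ᵇ toℕ x in q | b
  ... | true  | true  | _ = contradiction (toℕ-injective (ℕP.≤-antisym
                              (ℕP.≤ᵇ⇒≤ _ _ (subst T (sym p) _)) (ℕP.≤ᵇ⇒≤ _ _ (subst T (sym q) _)))) x≢y
  ... | true  | false | true = refl
  ... | true  | false | false = refl
  ... | false | true  | true = refl
  ... | false | true  | false = refl
  ... | false | false | _ with ℕP.≤-total (toℕ x) (toℕ y)
  ... | inj₁ le = ⊥-elim (subst T p (ℕP.≤⇒≤ᵇ le))
  ... | inj₂ le = ⊥-elim (subst T q (ℕP.≤⇒≤ᵇ le))

  w-sym : ∀ b x y → w b x y ≡ w b y x
  w-sym b (x , i) (y , j) with x FinP.≟ y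
  ... | yes refl = trans (w-tie b x i j) (sym (w-tie b x j i))
  ... | no x≢y rewrite out-flip b x y x≢y with out b x y
  ... | true  = refl
  ... | false = refl

  w-arcs : ∀ x y → (w false x y ≡ c x x y × w true x y ≡ c y y x)
                 ⊎ (w false x y ≡ c y y x × w true x y ≡ c x x y)
  w-arcs (x , i) (y , j) with toℕ x ≤ᵇ toℕ y
  ... | true  = inj₁ (refl , refl)
  ... | false = inj₂ (refl , refl)

  -- An out-arc to level next j and an in-arc from level j share a rank.  They cannot both count for the
  -- same infinite point: equal colours give equal first coordinates, and these alone decide the direction.
  w-point : ∀ b x → ThreeToOne (w b x)
  w-point b (x , i) = rank , inj _ _ _ _
    where
    rank : S → Fin 3
    rank (z , j) = if out b x z then j else next j

    crossed : ∀ j z z′ → c (x , i) (x , i) (z , next j) ≡ c (z′ , j) (z′ , j) (x , i) → z ≡ z′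
    crossed j z z′ eq = affine-injective (coprime-∣ coprime (2*weight∣24 j i)) _ z z′
      (trans (sym (trans (c-out x i z (next j))
        (cong₂ (λ p q → (p * toℕ x + q * toℕ z) mod u) (weight-out≡in₁ i j) (weight-out≡in₂ i j))))
        (trans eq (c-in z′ j x i)))

    inj : ∀ z j z′ j′ → w b (x , i) (z , j) ≡ w b (x , i) (z′ , j′) →
          rank (z , j) ≡ rank (z′ , j′) → (z , j) ≡ (z′ , j′)
    inj z j z′ j′ eq e with out b x z in p | out b x z′ in p′
    inj z j z′ .j eq refl | true  | true  = proj₂ (c-pair (x , i) (x , i)) eq refl
    inj z j z′ j′ eq e | false | false with refl ← next-injective j j′ e = cong (_, j) (in-injective x i j z z′ eq)
    inj z _ z′ j′ eq refl | true  | false with refl ← crossed j′ z z′ eq = contradiction (trans (sym p) p′) λ ()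
    inj z j z′ _ eq refl | false | true with refl ← crossed j z′ z (sym eq) = contradiction (trans (sym p) p′) λ ()

  affine : Colouring S (Fin u)
  affine = record
    { c = c ; c-sym₁₂ = c-sym₁₂ ; c-sym₂₃ = c-sym₂₃ ; c-pair = c-pair ; c-square = c-square
    ; c-cube = c-cube ; c-hole = c-hole ; w = w ; w-sym = w-sym ; w-arcs = w-arcs ; w-point = w-point }

-- Tripling

select : Fin 3 → Fin 3 → Fin 3 → Fin 3
select zero    p q = p
select (suc _) p q = q

opaque
  _⊕_ _⊖_ : Fin 3 → Fin 3 → Fin 3
  i ⊕ j = (toℕ i + toℕ j) mod 3
  i ⊖ j = (toℕ i + 2 * toℕ j) mod 3

  -- This is -(a + b) modulo 3: the remaining residue if `a` and `b` differ, and `a` itself if they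
  -- agree.
  third : Fin 3 → Fin 3 → Fin 3
  third a b = (2 * (toℕ a + toℕ b)) mod 3

  ⊕-comm : ∀ i j → i ⊕ j ≡ j ⊕ i
  ⊕-comm = from-yes (all? λ i → all? λ j → (i ⊕ j) FinP.≟ (j ⊕ i))

  ⊕-swap : ∀ i j k → (i ⊕ j) ⊕ k ≡ (i ⊕ k) ⊕ j
  ⊕-swap = from-yes (all? λ i → all? λ j → all? λ k → ((i ⊕ j) ⊕ k) FinP.≟ ((i ⊕ k) ⊕ j))

  ⊕-cancelˡ : ∀ i j k → i ⊕ j ≡ i ⊕ k → j ≡ k
  ⊕-cancelˡ = from-yes (all? λ i → all? λ j → all? λ k → ((i ⊕ j) FinP.≟ (i ⊕ k)) →-dec (j FinP.≟ k))

  ⊖-self : ∀ i → i ⊖ i ≡ zero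
  ⊖-self = from-yes (all? λ i → (i ⊖ i) FinP.≟ zero)

  ⊖-cancelʳ : ∀ i j k → j ⊖ i ≡ k ⊖ i → j ≡ k
  ⊖-cancelʳ = from-yes (all? λ i → all? λ j → all? λ k → ((j ⊖ i) FinP.≟ (k ⊖ i)) →-dec (j FinP.≟ k))

  -- The two differences are negatives of each other, and `select` asks only whether its argument
  -- vanishes.
  select-⊖ : ∀ i j p q → select (i ⊖ j) p q ≡ select (j ⊖ i) p q
  select-⊖ = from-yes (all? λ i → all? λ j → all? λ p → all? λ q →
    select (i ⊖ j) p q FinP.≟ select (j ⊖ i) p q)

  third-comm : ∀ a b → third a b ≡ third b a
  third-comm = from-yes (all? λ a → all? λ b → third a b FinP.≟ third b a)

  third≢ˡ : ∀ a b → a ≢ b → third a b ≢ a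
  third≢ˡ = from-yes (all? λ a → all? λ b → ¬? (a FinP.≟ b) →-dec ¬? (third a b FinP.≟ a))

  third-injective : ∀ a b e → third a b ≡ third a e → b ≡ e
  third-injective = from-yes (all? λ a → all? λ b → all? λ e →
    (third a b FinP.≟ third a e) →-dec (b FinP.≟ e))

  third-unique : ∀ a b e → a ≢ b → e ≢ a → e ≢ b → e ≡ third a b
  third-unique = from-yes (all? λ a → all? λ b → all? λ e →
    ¬? (a FinP.≟ b) →-dec (¬? (e FinP.≟ a) →-dec (¬? (e FinP.≟ b) →-dec (e FinP.≟ third a b))))

  -- Of two different residues modulo 3 exactly one is the successor of the other; this gives every
  -- pair of copies a direction.
  next-xor : ∀ a e b → a ≢ e → (⌊ e FinP.≟ next a ⌋ xor b) ≡ not (⌊ a FinP.≟ next e ⌋ xor b)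
  next-xor a e false = from-yes (all? λ a → all? λ e →
    ¬? (a FinP.≟ e) →-dec ((⌊ e FinP.≟ next a ⌋ xor false) BoolP.≟ not (⌊ a FinP.≟ next e ⌋ xor false))) a e
  next-xor a e true = from-yes (all? λ a → all? λ e →
    ¬? (a FinP.≟ e) →-dec ((⌊ e FinP.≟ next a ⌋ xor true) BoolP.≟ not (⌊ a FinP.≟ next e ⌋ xor true))) a e

third≢ʳ : ∀ a b → a ≢ b → third a b ≢ b
third≢ʳ a b a≢b e = third≢ˡ b a (a≢b ∘ sym) (trans (third-comm b a) e)

select-third≢ : ∀ g a e → e ≢ a → select g (third a e) e ≢ a
select-third≢ zero    a e e≢a = third≢ˡ a e (e≢a ∘ sym)
select-third≢ (suc _) a e e≢a = e≢a

select-third-injective : ∀ g a e e′ → select g (third a e) e ≡ select g (third a e′) e′ → e ≡ e′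
select-third-injective zero    a e e′ eq = third-injective a e e′ eq
select-third-injective (suc _) a e e′ eq = eq

data Copies : Fin 3 → Fin 3 → Fin 3 → Set where
  equal     : ∀ {a} → Copies a a a
  pair₁₂   : ∀ {a e} → a ≢ e → Copies a a e
  pair₁₃   : ∀ {a b} → a ≢ b → Copies a b a
  pair₂₃   : ∀ {a b} → a ≢ b → Copies a b b
  distinct : ∀ {a b e} → a ≢ b → a ≢ e → b ≢ e → Copies a b e

opaque
  copies : ∀ a b e → Copies a b e
  copies a b e with a FinP.≟ b | a FinP.≟ e | b FinP.≟ e
  ... | yes refl | yes refl | _        = equal
  ... | yes refl | no a≢e   | _        = pair₁₂ a≢e
  ... | no a≢b   | yes refl | _        = pair₁₃ a≢b
  ... | no a≢b   | no _     | yes refl = pair₂₃ a≢b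
  ... | no a≢b   | no a≢e   | no b≢e   = distinct a≢b a≢e b≢e

data Location (a b e : Fin 3) : Set where
  first  : e ≡ a → Location a b e
  second : e ≡ b → Location a b e
  other  : e ≢ a → e ≢ b → Location a b e

locate : ∀ a b e → Location a b e
locate a b e with e FinP.≟ a | e FinP.≟ b
... | yes e≡a | _       = first e≡a
... | no _    | yes e≡b = second e≡b
... | no e≢a  | no e≢b  = other e≢a e≢b

module Tripling (u : ℕ) .{{_ : NonZero u}} (coprime : Coprime u 2)
                (base : Colouring (Fin u × Fin 3) (Fin u)) where
  open Colouring base

  S S³ I³ : Set
  S  = Fin u × Fin 3
  S³ = S × Fin 3
  I³ = Fin u × Fin 3

  -- The factor 1 gives the sum the shape `a + w * toℕ z` of `affine-injective`.
  total : S → S → S → Fin u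
  total (x , _) (y , _) (z , _) = (toℕ x + toℕ y + 1 * toℕ z) mod u

  total-comm : ∀ x y z → total x y z ≡ total y x z
  total-comm (x , _) (y , _) (z , _) = cong (λ s → (s + 1 * toℕ z) mod u) (ℕP.+-comm (toℕ x) (toℕ y))

  total-swap : ∀ x y z → total x y z ≡ total x z y
  total-swap (x , _) (y , _) (z , _) = cong (_mod u) (ring (toℕ x) (toℕ y) (toℕ z))
    where
    ring : ∀ p q r → p + q + 1 * r ≡ p + r + 1 * q
    ring = solve-∀

  total-injective : ∀ x y z z′ → total x y z ≡ total x y z′ → proj₁ z ≡ proj₁ z′
  total-injective (x , _) (y , _) (z , _) (z′ , _) =
    affine-injective {w = 1} (λ (d∣u , d∣1) → coprime (d∣u , ∣-trans d∣1 (divides 2 refl))) (toℕ x + toℕ y) z z′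

  -- A repeated point enters the sum with the factor 2; here the tripling uses that 2 is a unit
  -- modulo `u`.
  total-injective₂ : ∀ y z z′ → total z z y ≡ total z′ z′ y → proj₁ z ≡ proj₁ z′
  total-injective₂ (y , _) (z , _) (z′ , _) eq = affine-injective {w = 2} coprime (toℕ y) z z′
    (trans (cong (_mod u) (ring (toℕ y) (toℕ z))) (trans eq (cong (_mod u) (sym (ring (toℕ y) (toℕ z′))))))
    where
    ring : ∀ p q → p + 2 * q ≡ q + q + 1 * p
    ring = solve-∀

  -- The triple of x and z in copy a and y in copy b goes to the third copy when the gap vanishes and to
  -- copy b otherwise.  For fixed first coordinates the gap is injective in the level of z.
  gap : S → S → S → Fin 3
  gap (x , i) (z , k) (y , j) = if ⌊ x FinP.≟ z ⌋ then k ⊖ i else ((i ⊕ k) ⊕ j)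

  -- This sends the arcs between two copies, in both directions, to the third copy of the colours.
  gap-self : ∀ z y → gap z z y ≡ zero
  gap-self (z , k) y with z FinP.≟ z
  ... | yes _  = ⊖-self k
  ... | no z≢z = contradiction refl z≢z

  select-gap-sym : ∀ x z y p q → select (gap x z y) p q ≡ select (gap z x y) p q
  select-gap-sym (x , i) (z , k) (y , j) p q with x FinP.≟ z | z FinP.≟ x
  ... | yes _   | yes _   = select-⊖ k i p q
  ... | yes x≡z | no z≢x  = contradiction (sym x≡z) z≢x
  ... | no x≢z  | yes z≡x = contradiction (sym z≡x) x≢z
  ... | no _    | no _    = cong (λ g → select (g ⊕ j) p q) (⊕-comm i k)

  gap-injective : ∀ x y {z k k′} → gap x (z , k) y ≡ gap x (z , k′) y → k ≡ k′
  gap-injective (x , i) (y , j) {z} {k} {k′} eq with x FinP.≟ z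
  ... | yes _ = ⊖-cancelʳ i k k′ eq
  ... | no _  = ⊕-cancelˡ (i ⊕ j) k k′ (trans (⊕-swap i j k) (trans eq (⊕-swap i k′ j)))

  colour : ∀ {a b e} → S → S → S → Copies a b e → I³
  colour {a} x y z equal                     = c x y z , a
  colour {a} {_} {e} x y z (pair₁₂ _)       = total x y z , select (gap x y z) (third a e) e
  colour {a} {b} x y z (pair₁₃ _)           = total x y z , select (gap x z y) (third a b) b
  colour {a} {b} x y z (pair₂₃ _)           = total x y z , select (gap y z x) (third b a) a
  -- With two of the points fixed, the level of the remaining one meets each copy of the colours
  -- once.
  colour x y z (distinct _ _ _)             = total x y z , (proj₂ x ⊕ proj₂ y) ⊕ proj₂ z

  c³ : S³ → S³ → S³ → I³
  c³ (x , a) (y , b) (z , e) = colour x y z (copies a b e)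

  c³-same : ∀ x y z a → c³ (x , a) (y , a) (z , a) ≡ (c x y z , a)
  c³-same x y z a with copies a a a
  ... | equal           = refl
  ... | pair₁₂ ne       = contradiction refl ne
  ... | pair₁₃ ne       = contradiction refl ne
  ... | pair₂₃ ne       = contradiction refl ne
  ... | distinct ne _ _ = contradiction refl ne

  c³-pair₁₂ : ∀ x y z {a e} → a ≢ e →
              c³ (x , a) (y , a) (z , e) ≡ (total x y z , select (gap x y z) (third a e) e)
  c³-pair₁₂ x y z {a} {e} a≢e with copies a a e
  ... | equal            = contradiction refl a≢e
  ... | pair₁₂ _        = refl
  ... | pair₁₃ ne       = contradiction refl ne
  ... | pair₂₃ ne       = contradiction refl ne
  ... | distinct ne _ _ = contradiction refl ne

  c³-pair₁₃ : ∀ x y z {a b} → a ≢ b →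
              c³ (x , a) (y , b) (z , a) ≡ (total x y z , select (gap x z y) (third a b) b)
  c³-pair₁₃ x y z {a} {b} a≢b with copies a b a
  ... | equal            = contradiction refl a≢b
  ... | pair₁₂ ne       = contradiction refl ne
  ... | pair₁₃ _        = refl
  ... | pair₂₃ ne       = contradiction refl ne
  ... | distinct _ ne _ = contradiction refl ne

  c³-pair₂₃ : ∀ x y z {a b} → a ≢ b →
              c³ (x , a) (y , b) (z , b) ≡ (total x y z , select (gap y z x) (third b a) a)
  c³-pair₂₃ x y z {a} {b} a≢b with copies a b b
  ... | equal            = contradiction refl a≢b
  ... | pair₁₂ ne       = contradiction refl ne
  ... | pair₁₃ ne       = contradiction refl ne
  ... | pair₂₃ _        = refl
  ... | distinct _ _ ne = contradiction refl ne

  c³-distinct : ∀ x y z {a b e} → a ≢ b → a ≢ e → b ≢ e →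
                c³ (x , a) (y , b) (z , e) ≡ (total x y z , (proj₂ x ⊕ proj₂ y) ⊕ proj₂ z)
  c³-distinct x y z {a} {b} {e} a≢b a≢e b≢e with copies a b e
  ... | equal           = contradiction refl a≢b
  ... | pair₁₂ _       = contradiction refl a≢b
  ... | pair₁₃ _       = contradiction refl a≢e
  ... | pair₂₃ _       = contradiction refl b≢e
  ... | distinct _ _ _ = refl

  c³-sym₁₂ : ∀ P Q R → c³ P Q R ≡ c³ Q P R
  c³-sym₁₂ (x , a) (y , b) (z , e) with copies a b e
  ... | equal = trans (cong (_, a) (c-sym₁₂ x y z)) (sym (c³-same y x z a))
  ... | pair₁₂ ne = trans (cong₂ _,_ (total-comm x y z) (select-gap-sym x y z _ _)) (sym (c³-pair₁₂ y x z ne))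
  ... | pair₁₃ ne = trans (cong₂ _,_ (total-comm x y z) refl) (sym (c³-pair₂₃ y x z (ne ∘ sym)))
  ... | pair₂₃ ne = trans (cong₂ _,_ (total-comm x y z) refl) (sym (c³-pair₁₃ y x z (ne ∘ sym)))
  ... | distinct p q r = trans (cong₂ _,_ (total-comm x y z) (cong (_⊕ proj₂ z) (⊕-comm (proj₂ x) (proj₂ y))))
                               (sym (c³-distinct y x z (p ∘ sym) r q))

  c³-sym₂₃ : ∀ P Q R → c³ P Q R ≡ c³ P R Q
  c³-sym₂₃ (x , a) (y , b) (z , e) with copies a b e
  ... | equal = trans (cong (_, a) (c-sym₂₃ x y z)) (sym (c³-same x z y a))
  ... | pair₁₂ ne = trans (cong₂ _,_ (total-swap x y z) refl) (sym (c³-pair₁₃ x z y ne))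
  ... | pair₁₃ ne = trans (cong₂ _,_ (total-swap x y z) refl) (sym (c³-pair₁₂ x z y ne))
  ... | pair₂₃ ne = trans (cong₂ _,_ (total-swap x y z) (select-gap-sym y z x _ _)) (sym (c³-pair₂₃ x z y ne))
  ... | distinct p q r = trans (cong₂ _,_ (total-swap x y z) (⊕-swap (proj₂ x) (proj₂ y) (proj₂ z)))
                               (sym (c³-distinct x z y q p (r ∘ sym)))

  -- Copy `a` of the colours is met by the points of copy `a` alone, so these can keep their rank
  -- while all other points are ranked by their level.
  layered : ∀ (f : S³ → I³) a {h} → ThreeToOne h → (∀ z → f (z , a) ≡ (h z , a)) →
            (∀ z e → e ≢ a → proj₂ (f (z , e)) ≢ a) →
            (∀ z e z′ e′ → e ≢ a → e′ ≢ a → f (z , e) ≡ f (z′ , e′) → proj₂ z ≡ proj₂ z′ → (z , e) ≡ (z′ , e′)) →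
            ThreeToOne f
  layered f a {h} (rank , inj) inside outside≢ outside = rank′ , inj′ _ _ _ _
    where
    rank′ : S³ → Fin 3
    rank′ (z , e) = if ⌊ e FinP.≟ a ⌋ then rank z else proj₂ z
    inj′ : ∀ z e z′ e′ → f (z , e) ≡ f (z′ , e′) → rank′ (z , e) ≡ rank′ (z′ , e′) → (z , e) ≡ (z′ , e′)
    inj′ z e z′ e′ eq req with e FinP.≟ a | e′ FinP.≟ a
    ... | yes refl | yes refl = cong (_, a) (inj (cong proj₁ (trans (sym (inside z)) (trans eq (inside z′)))) req)
    ... | yes refl | no e′≢a  = contradiction (trans (cong proj₂ (sym eq)) (cong proj₂ (inside z))) (outside≢ z′ e′ e′≢a)
    ... | no e≢a   | yes refl = contradiction (trans (cong proj₂ eq) (cong proj₂ (inside z′))) (outside≢ z e e≢a)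
    ... | no e≢a   | no e′≢a  = outside z e z′ e′ e≢a e′≢a eq req

  c³-pair-same : ∀ x y a → ThreeToOne (c³ (x , a) (y , a))
  c³-pair-same x y a = layered _ a (c-pair x y) (λ z → c³-same x y z a)
    (λ z e e≢a → subst (_≢ a) (cong proj₂ (sym (c³-pair₁₂ x y z (e≢a ∘ sym))))
                   (select-third≢ (gap x y z) a e e≢a))
    outside
    where
    outside : ∀ z e z′ e′ → e ≢ a → e′ ≢ a → c³ (x , a) (y , a) (z , e) ≡ c³ (x , a) (y , a) (z′ , e′) →
              proj₂ z ≡ proj₂ z′ → (z , e) ≡ (z′ , e′)
    outside z e z′ e′ e≢a e′≢a eq refl
      with eq′ ← trans (sym (c³-pair₁₂ x y z (e≢a ∘ sym))) (trans eq (c³-pair₁₂ x y z′ (e′≢a ∘ sym)))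
      with refl ← total-injective x y z z′ (cong proj₁ eq′)
      = cong (z ,_) (select-third-injective (gap x y z) a e e′ (cong proj₂ eq′))

  -- Rank 0 is reserved for points of the third copy. A vanishing gap is therefore ranked 1 or 2,
  -- according to the copy the point comes from, since in both cases the colour lies in the third
  -- copy.
  orZero : Fin 2 → Fin 3 → Fin 3
  orZero v zero    = suc v
  orZero v (suc g) = suc g

  orZero-injective : ∀ v {p q} g g′ → p ≢ q → select g p q ≡ select g′ p q → orZero v g ≡ orZero v g′ → g ≡ g′
  orZero-injective v zero    zero     _ _ _ = refl
  orZero-injective v zero    (suc _) ne e _ = contradiction e ne
  orZero-injective v (suc _) zero    ne e _ = contradiction (sym e) ne
  orZero-injective v (suc _) (suc _) _ _ e  = e

  orZero≢0 : ∀ v g → orZero v g ≢ zero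
  orZero≢0 v zero    ()
  orZero≢0 v (suc g) ()

  -- Fix the first coordinate of the third point. Its three levels in copy `a` give one colour in
  -- copy `t` and two in copy `b`; in copy `b` they give one in `t` and two in `a`; in copy `t` they
  -- give one in each. Every copy of the colours is thus met three times.
  c³-pair-distinct : ∀ x y a b → a ≢ b → ThreeToOne (c³ (x , a) (y , b))
  c³-pair-distinct x y a b a≢b = rank , inj _ _ _ _
    where
    t = third a b

    rank : S³ → Fin 3
    rank (z , e) with locate a b e
    ... | first _   = orZero zero (gap x z y)
    ... | second _  = orZero (suc zero) (gap y z x)
    ... | other _ _ = zero

    at-first : ∀ z → c³ (x , a) (y , b) (z , a) ≡ (total x y z , select (gap x z y) t b)
    at-first z = c³-pair₁₃ x y z a≢b

    at-second : ∀ z → c³ (x , a) (y , b) (z , b) ≡ (total x y z , select (gap y z x) t a)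
    at-second z = trans (c³-pair₂₃ x y z a≢b)
                        (cong (λ s → total x y z , select (gap y z x) s a) (third-comm b a))

    clash : ∀ g g′ → select g t b ≡ select g′ t a → orZero zero g ≢ orZero (suc zero) g′
    clash zero    zero    _ ()
    clash zero    (suc _) e _ = third≢ˡ a b a≢b e
    clash (suc _) zero    e _ = third≢ʳ a b a≢b (sym e)
    clash (suc _) (suc _) e _ = a≢b (sym e)

    inj : ∀ z e z′ e′ → c³ (x , a) (y , b) (z , e) ≡ c³ (x , a) (y , b) (z′ , e′) →
          rank (z , e) ≡ rank (z′ , e′) → (z , e) ≡ (z′ , e′)
    inj z e z′ e′ eq req with locate a b e | locate a b e′
    inj z _ z′ _ eq req | first refl | first refl
      with eq′ ← trans (sym (at-first z)) (trans eq (at-first z′))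
      with refl ← total-injective x y z z′ (cong proj₁ eq′)
      with refl ← gap-injective x y (orZero-injective zero (gap x z y) (gap x z′ y) (third≢ʳ a b a≢b) (cong proj₂ eq′) req)
      = refl
    inj z _ z′ _ eq req | second refl | second refl
      with eq′ ← trans (sym (at-second z)) (trans eq (at-second z′))
      with refl ← total-injective x y z z′ (cong proj₁ eq′)
      with refl ← gap-injective y x (orZero-injective (suc zero) (gap y z x) (gap y z′ x) (third≢ˡ a b a≢b) (cong proj₂ eq′) req)
      = refl
    inj z e z′ e′ eq req | other p q | other p′ q′
      with refl ← trans (third-unique a b e a≢b p q) (sym (third-unique a b e′ a≢b p′ q′))
      with eq′ ← trans (sym (c³-distinct x y z a≢b (p ∘ sym) (q ∘ sym))) (trans eq (c³-distinct x y z′ a≢b (p ∘ sym) (q ∘ sym)))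
      with refl ← total-injective x y z z′ (cong proj₁ eq′)
      with refl ← ⊕-cancelˡ (proj₂ x ⊕ proj₂ y) (proj₂ z) (proj₂ z′) (cong proj₂ eq′)
      = refl
    inj z _ z′ _ eq req | first refl | second refl =
      contradiction req (clash (gap x z y) (gap y z′ x) (cong proj₂ (trans (sym (at-first z)) (trans eq (at-second z′)))))
    inj z _ z′ _ eq req | second refl | first refl =
      contradiction (sym req) (clash (gap x z′ y) (gap y z x) (cong proj₂ (trans (sym (at-first z′)) (trans (sym eq) (at-second z)))))
    inj z _ z′ _ eq req | first _   | other _ _ = contradiction req (orZero≢0 _ (gap x z y))
    inj z _ z′ _ eq req | second _  | other _ _ = contradiction req (orZero≢0 _ (gap y z x))
    inj z _ z′ _ eq req | other _ _ | first _   = contradiction (sym req) (orZero≢0 _ (gap x z′ y))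
    inj z _ z′ _ eq req | other _ _ | second _  = contradiction (sym req) (orZero≢0 _ (gap y z′ x))

  c³-pair : ∀ P Q → ThreeToOne (c³ P Q)
  c³-pair (x , a) (y , b) with a FinP.≟ b
  ... | yes refl = c³-pair-same x y a
  ... | no a≢b   = c³-pair-distinct x y a b a≢b

  c³-out : ∀ x y {a e} → a ≢ e → c³ (x , a) (x , a) (y , e) ≡ (total x x y , third a e)
  c³-out x y {a} {e} a≢e = trans (c³-pair₁₂ x x y a≢e)
    (cong (λ g → total x x y , select g (third a e) e) (gap-self x y))

  c³-square : ∀ Q → ThreeToOne (λ R → c³ R R Q)
  c³-square (y , b) = layered _ b (c-square y) (λ z → c³-same z z y b)
    (λ z e e≢b → subst (_≢ b) (cong proj₂ (sym (c³-out z y e≢b))) (third≢ʳ e b e≢b))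
    outside
    where
    outside : ∀ z e z′ e′ → e ≢ b → e′ ≢ b → c³ (z , e) (z , e) (y , b) ≡ c³ (z′ , e′) (z′ , e′) (y , b) →
              proj₂ z ≡ proj₂ z′ → (z , e) ≡ (z′ , e′)
    outside z e z′ e′ e≢b e′≢b eq refl
      with eq′ ← trans (sym (c³-out z y e≢b)) (trans eq (c³-out z′ y e′≢b))
      with refl ← total-injective₂ y z z′ (cong proj₁ eq′)
      = cong (z ,_) (third-injective b e e′ (trans (third-comm b e) (trans (cong proj₂ eq′) (third-comm e′ b))))

  c³-cube : ThreeToOne (λ R → c³ R R R)
  c³-cube = (λ (z , _) → proj₁ c-cube z) , λ {(z , e)} {(z′ , e′)} eq req →
    let eq′ = trans (sym (c³-same z z z e)) (trans eq (c³-same z′ z′ z′ e′))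
    in cong₂ _,_ (proj₂ c-cube (cong proj₁ eq′) req) (cong proj₂ eq′)

  c³-hole : ∀ P Q R → c³ P P P ≡ c³ Q Q Q → c³ P P P ≡ c³ R R R → c³ P Q R ≡ c³ P P P
  c³-hole (x , a) (y , b) (z , e) PQ PR
    with PQ′ ← trans (sym (c³-same x x x a)) (trans PQ (c³-same y y y b))
       | PR′ ← trans (sym (c³-same x x x a)) (trans PR (c³-same z z z e))
    with refl ← cong proj₂ PQ′ | refl ← cong proj₂ PR′ =
    trans (c³-same x y z a) (trans (cong (_, a) (c-hole x y z (cong proj₁ PQ′) (cong proj₁ PR′)))
                                   (sym (c³-same x x x a)))

  -- Between different copies the direction depends on the copies alone. From a fixed point to a
  -- fixed copy `e` only one of the two sums occurs, and `third a e` recalls `e`, so out-arcs and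
  -- in-arcs never compete for a colour.
  w³ : Bool → S³ → S³ → I³
  w³ b (x , a) (y , e) =
    if ⌊ a FinP.≟ e ⌋ then (w b x y , a)
    else if (⌊ e FinP.≟ next a ⌋ xor b) then (total x x y , third a e) else (total y y x , third a e)

  w³-same : ∀ b x y a → w³ b (x , a) (y , a) ≡ (w b x y , a)
  w³-same b x y a with a FinP.≟ a
  ... | yes _ = refl
  ... | no a≢a = contradiction refl a≢a

  w³-sym : ∀ b P Q → w³ b P Q ≡ w³ b Q P
  w³-sym b (x , a) (y , e) with a FinP.≟ e | e FinP.≟ a
  ... | yes refl | yes _   = cong (_, a) (w-sym b x y)
  ... | yes a≡e  | no e≢a  = contradiction (sym a≡e) e≢a
  ... | no a≢e   | yes e≡a = contradiction (sym e≡a) a≢e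
  ... | no a≢e   | no _ rewrite next-xor a e b a≢e | third-comm a e with ⌊ a FinP.≟ next e ⌋ xor b
  ... | true  = refl
  ... | false = refl

  w³-arcs : ∀ P Q → (w³ false P Q ≡ c³ P P Q × w³ true P Q ≡ c³ Q Q P)
                  ⊎ (w³ false P Q ≡ c³ Q Q P × w³ true P Q ≡ c³ P P Q)
  w³-arcs (x , a) (y , e) with a FinP.≟ e
  ... | yes refl rewrite c³-same x x y a | c³-same y y x a with w-arcs x y
  ... | inj₁ (p , q) = inj₁ (cong (_, a) p , cong (_, a) q)
  ... | inj₂ (p , q) = inj₂ (cong (_, a) p , cong (_, a) q)
  w³-arcs (x , a) (y , e) | no a≢e
    rewrite c³-out x y a≢e | c³-out y x (a≢e ∘ sym) | third-comm e a with ⌊ e FinP.≟ next a ⌋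
  ... | true  = inj₁ (refl , refl)
  ... | false = inj₂ (refl , refl)

  w³-point : ∀ b P → ThreeToOne (w³ b P)
  w³-point b (x , a) = layered _ a (w-point b x) (λ z → w³-same b x z a) outside≢ outside
    where
    copy : ∀ z e → e ≢ a → proj₂ (w³ b (x , a) (z , e)) ≡ third a e
    copy z e e≢a with a FinP.≟ e
    ... | yes a≡e = contradiction (sym a≡e) e≢a
    ... | no _ with ⌊ e FinP.≟ next a ⌋ xor b
    ... | true  = refl
    ... | false = refl

    outside≢ : ∀ z e → e ≢ a → proj₂ (w³ b (x , a) (z , e)) ≢ a
    outside≢ z e e≢a = subst (_≢ a) (sym (copy z e e≢a)) (third≢ˡ a e (e≢a ∘ sym))

    first-coordinate : ∀ z z′ e → e ≢ a → w³ b (x , a) (z , e) ≡ w³ b (x , a) (z′ , e) → proj₁ z ≡ proj₁ z′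
    first-coordinate z z′ e e≢a eq with a FinP.≟ e
    ... | yes a≡e = contradiction (sym a≡e) e≢a
    ... | no _ with ⌊ e FinP.≟ next a ⌋ xor b
    ... | true  = total-injective x x z z′ (cong proj₁ eq)
    ... | false = total-injective₂ x z z′ (cong proj₁ eq)

    outside : ∀ z e z′ e′ → e ≢ a → e′ ≢ a → w³ b (x , a) (z , e) ≡ w³ b (x , a) (z′ , e′) →
              proj₂ z ≡ proj₂ z′ → (z , e) ≡ (z′ , e′)
    outside z e z′ e′ e≢a e′≢a eq refl
      with refl ← third-injective a e e′ (trans (sym (copy z e e≢a)) (trans (cong proj₂ eq) (copy z′ e′ e′≢a)))
      with refl ← first-coordinate z z′ e e≢a eq
      = refl

  tripled : Colouring S³ I³
  tripled = record
    { c = c³ ; c-sym₁₂ = c³-sym₁₂ ; c-sym₂₃ = c³-sym₂₃ ; c-pair = c³-pair ; c-square = c³-square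
    ; c-cube = c³-cube ; c-hole = c³-hole ; w = w³ ; w-sym = w³-sym ; w-arcs = w³-arcs ; w-point = w³-point }

-- From a colouring to the designs

module _ {v : ℕ} where

  mult-∉ : ∀ {B : Block v} {Bs} → B ∉ₗ Bs → mult B Bs ≡ 0
  mult-∉ {B} B∉ = cong length (filter-none (λ C → C ≟B B) (All.tabulate λ { C∈ refl → B∉ C∈ }))

  mult-∈ : ∀ {B : Block v} {Bs} → Unique Bs → B ∈ₗ Bs → mult B Bs ≡ 1
  mult-∈ {B} un B∈ = length-filter-unique (λ C → C ≟B B) un ([] ∷ []) λ C →
    mk⇔ (λ { (here refl) → B∈ , refl }) (λ { (_ , refl) → here refl })

  tri : Fin v → Fin v → Fin v → Block v
  tri x y z = ⁅ x ⁆ ∪ ⁅ y ⁆ ∪ ⁅ z ⁆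

  ∈-tri⁻ : ∀ {p x y z} → p ∈ tri x y z → p ≡ x ⊎ p ≡ y ⊎ p ≡ z
  ∈-tri⁻ {p} {x} {y} {z} p∈ with x∈p∪q⁻ ⁅ x ⁆ (⁅ y ⁆ ∪ ⁅ z ⁆) p∈
  ... | inj₁ q = inj₁ (x∈⁅y⁆⇒x≡y x q)
  ... | inj₂ q with x∈p∪q⁻ ⁅ y ⁆ ⁅ z ⁆ q
  ... | inj₁ s = inj₂ (inj₁ (x∈⁅y⁆⇒x≡y y s))
  ... | inj₂ s = inj₂ (inj₂ (x∈⁅y⁆⇒x≡y z s))

  ∈-tri₁ : ∀ {x y z} → x ∈ tri x y z
  ∈-tri₁ {x} = x∈p∪q⁺ (inj₁ (x∈⁅x⁆ x))

  ∈-tri₂ : ∀ {x y z} → y ∈ tri x y z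
  ∈-tri₂ {x} {y} {z} = x∈p∪q⁺ {p = ⁅ x ⁆} (inj₂ (x∈p∪q⁺ (inj₁ (x∈⁅x⁆ y))))

  ∈-tri₃ : ∀ {x y z} → z ∈ tri x y z
  ∈-tri₃ {x} {y} {z} = x∈p∪q⁺ {p = ⁅ x ⁆} (inj₂ (x∈p∪q⁺ {p = ⁅ y ⁆} (inj₂ (x∈⁅x⁆ z))))

  tri⊆ : ∀ {x y z} {B : Block v} → x ∈ B → y ∈ B → z ∈ B → tri x y z ⊆ B
  tri⊆ x∈ y∈ z∈ p∈ with ∈-tri⁻ p∈
  ... | inj₁ refl        = x∈
  ... | inj₂ (inj₁ refl) = y∈
  ... | inj₂ (inj₂ refl) = z∈

  ∣tri∣ : ∀ {x y z} → x ≢ y → x ≢ z → y ≢ z → ∣ tri x y z ∣ ≡ 3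
  ∣tri∣ {x} {y} {z} x≢y x≢z y≢z = ∣∣-unique (tri x y z) {x ∷ y ∷ z ∷ []}
    ((x≢y ∷ x≢z ∷ []) ∷ (y≢z ∷ []) ∷ [] ∷ []) λ p → mk⇔ (listed ∘ ∈-tri⁻) λ where
      (here refl) → ∈-tri₁
      (there (here refl)) → ∈-tri₂ {x}
      (there (there (here refl))) → ∈-tri₃ {x} {y}
    where
    listed : ∀ {p} → p ≡ x ⊎ p ≡ y ⊎ p ≡ z → p ∈ₗ (x ∷ y ∷ z ∷ [])
    listed (inj₁ refl)        = here refl
    listed (inj₂ (inj₁ refl)) = there (here refl)
    listed (inj₂ (inj₂ refl)) = there (there (here refl))

  ∣tri∣-repeated : ∀ {x y} → x ≢ y → ∣ tri x y y ∣ ≡ 2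
  ∣tri∣-repeated {x} {y} x≢y = ∣∣-unique (tri x y y) {x ∷ y ∷ []}
    ((x≢y ∷ []) ∷ [] ∷ []) λ p → mk⇔ (listed ∘ ∈-tri⁻) λ where
      (here refl) → ∈-tri₁
      (there (here refl)) → ∈-tri₂ {x}
    where
    listed : ∀ {p} → p ≡ x ⊎ p ≡ y ⊎ p ≡ y → p ∈ₗ (x ∷ y ∷ [])
    listed (inj₁ refl)        = here refl
    listed (inj₂ (inj₁ refl)) = there (here refl)
    listed (inj₂ (inj₂ refl)) = there (here refl)

-- Families of designs indexed by the colours

module Family {n u : ℕ} (D : Fin u → GDesign n) where

  family : List (GDesign n)
  family = map D (allFin u)

  ∈-family⁻ : ∀ {P : GDesign n → Set} → (∀ r → P (D r)) → ∀ d → d ∈ₗ family → P d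
  ∈-family⁻ p d d∈ with r , _ , refl ← ∈-map⁻ D d∈ = p r

  ∈-blocks⁻ : ∀ {P : List (Block (2 + n)) → Set} → (∀ r → P (blocks (D r))) → ∀ Bs → Bs ∈ₗ map blocks family → P Bs
  ∈-blocks⁻ p Bs Bs∈ with d , d∈ , refl ← ∈-map⁻ blocks Bs∈ = ∈-family⁻ p d d∈

  ∈-union⁺ : ∀ {B} r → B ∈ₗ blocks (D r) → InUnion (map blocks family) B
  ∈-union⁺ r B∈ = blocks (D r) , ∈-map⁺ blocks (∈-map⁺ D (∈-allFin r)) , B∈

  ∈-union⁻ : ∀ {B} → InUnion (map blocks family) B → ∃ λ r → B ∈ₗ blocks (D r)
  ∈-union⁻ {B} (Bs , Bs∈ , B∈) = ∈-blocks⁻ {λ Bs → B ∈ₗ Bs → ∃ λ r → B ∈ₗ blocks (D r)} _,_ Bs Bs∈ B∈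

  sum-mult : ∀ {B k} r → mult B (blocks (D r)) ≡ k → (∀ s → s ≢ r → B ∉ₗ blocks (D s)) →
             sum (map (mult B) (map blocks family)) ≡ k
  sum-mult {B} {k} r here-k elsewhere = begin
    sum (map (mult B) (map blocks (map D (allFin u))))  ≡⟨ cong sum (map-∘ (map D (allFin u))) ⟨
    sum (map (mult B ∘ blocks) (map D (allFin u)))      ≡⟨ cong sum (map-∘ (allFin u)) ⟨
    sum (map (mult B ∘ blocks ∘ D) (allFin u))          ≡⟨ sum-single (mult B ∘ blocks ∘ D) (allFin⁺ u) (∈-allFin r) (λ s ne → mult-∉ (elsewhere s ne)) ⟩
    mult B (blocks (D r))                               ≡⟨ here-k ⟩
    k                                                   ∎
    where open ≡-Reasoning

  arcCount-family : ∀ x y r → (∀ s → arcs (D s) x y ≡ true ⇔ s ≡ r) → arcCount family x y ≡ 1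
  arcCount-family x y r same = trans (length-filter-map (λ d → arcs d x y BoolP.≟ true) D (allFin u))
    (length-filter-unique (λ s → arcs (D s) x y BoolP.≟ true) (allFin⁺ u) ([] ∷ []) λ s →
      mk⇔ (λ { (here refl) → ∈-allFin s , from (same s) refl }) (λ (_ , a) → here (to (same s) a)))

inf : ∀ {n} → Bool → Fin (2 + n)
inf false = ∞₁
inf true  = ∞₂

split : ∀ {n} → Fin (2 + n) → Bool ⊎ Fin n
split zero          = inj₁ false
split (suc zero)    = inj₁ true
split (suc (suc z)) = inj₂ z

split-inf : ∀ {n} b → split {n} (inf b) ≡ inj₁ b
split-inf false = refl
split-inf true  = refl

join : ∀ {n} → Bool ⊎ Fin n → Fin (2 + n)
join (inj₁ b) = inf b
join (inj₂ z) = pt z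

join-split : ∀ {n} (p : Fin (2 + n)) → join (split p) ≡ p
join-split zero          = refl
join-split (suc zero)    = refl
join-split (suc (suc z)) = refl

inf≢pt : ∀ {n} b {z : Fin n} → inf b ≢ pt z
inf≢pt false ()
inf≢pt true  ()

inf-not : ∀ {n} b → inf {n} b ≢ inf (not b)
inf-not false ()
inf-not true  ()

pt-injective : ∀ {n} {x y : Fin n} → pt x ≡ pt y → x ≡ y
pt-injective refl = refl

-- Colours of triples that may contain infinite points

module Designs {n u : ℕ} (n≡u*3 : n ≡ u * 3) (base : Colouring (Fin n) (Fin u)) (default : Fin u) where
  open Colouring base
  open ThreeToOneProperties {n} {u} n≡u*3

  X : Set
  X = Fin (2 + n)

  c-hole′ : ∀ {r} x y z → c x x x ≡ r → c y y y ≡ r → c z z z ≡ r → c x y z ≡ r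
  c-hole′ x y z px py pz = trans (c-hole x y z (trans px (sym py)) (trans px (sym pz))) px

  w-hole : ∀ {r} b x y → c x x x ≡ r → c y y y ≡ r → w b x y ≡ r
  w-hole b x y px py with w-arcs x y | b
  ... | inj₁ (p , _) | false = trans p (c-hole′ x x y px px py)
  ... | inj₁ (_ , q) | true  = trans q (c-hole′ y y x py py px)
  ... | inj₂ (p , _) | false = trans p (c-hole′ y y x py py px)
  ... | inj₂ (_ , q) | true  = trans q (c-hole′ x x y px px py)

  -- Among the third points of an infinite point and `x`, the place of `x` is taken by the other
  -- infinite point; its colour there must be that of {∞₁,∞₂,x}.
  w-diagonal : ∀ b x → w b x x ≡ c x x x
  w-diagonal b x = w-hole b x x refl refl

  w-choice : ∀ x y → ∃ λ b → w b x y ≡ c x x y × w (not b) x y ≡ c y y x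
  w-choice x y with w-arcs x y
  ... | inj₁ (p , q) = false , p , q
  ... | inj₂ (p , q) = true , q , p

  -- The value default is junk: it occurs only for three infinite points, which are never distinct.
  colour : Bool ⊎ Fin n → Bool ⊎ Fin n → Bool ⊎ Fin n → Fin u
  colour (inj₂ x) (inj₂ y) (inj₂ z) = c x y z
  colour (inj₁ b) (inj₂ x) (inj₂ y) = w b x y
  colour (inj₂ x) (inj₁ b) (inj₂ y) = w b x y
  colour (inj₂ x) (inj₂ y) (inj₁ b) = w b x y
  colour (inj₁ _) (inj₁ _) (inj₂ x) = c x x x
  colour (inj₁ _) (inj₂ x) (inj₁ _) = c x x x
  colour (inj₂ x) (inj₁ _) (inj₁ _) = c x x x
  colour (inj₁ _) (inj₁ _) (inj₁ _) = default

  colour-sym₁₂ : ∀ x y z → colour x y z ≡ colour y x z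
  colour-sym₁₂ (inj₂ x) (inj₂ y) (inj₂ z) = c-sym₁₂ x y z
  colour-sym₁₂ (inj₁ b) (inj₂ x) (inj₂ y) = refl
  colour-sym₁₂ (inj₂ x) (inj₁ b) (inj₂ y) = refl
  colour-sym₁₂ (inj₂ x) (inj₂ y) (inj₁ b) = w-sym b x y
  colour-sym₁₂ (inj₁ _) (inj₁ _) (inj₂ x) = refl
  colour-sym₁₂ (inj₁ _) (inj₂ x) (inj₁ _) = refl
  colour-sym₁₂ (inj₂ x) (inj₁ _) (inj₁ _) = refl
  colour-sym₁₂ (inj₁ _) (inj₁ _) (inj₁ _) = refl

  colour-sym₂₃ : ∀ x y z → colour x y z ≡ colour x z y
  colour-sym₂₃ (inj₂ x) (inj₂ y) (inj₂ z) = c-sym₂₃ x y z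
  colour-sym₂₃ (inj₁ b) (inj₂ x) (inj₂ y) = w-sym b x y
  colour-sym₂₃ (inj₂ x) (inj₁ b) (inj₂ y) = refl
  colour-sym₂₃ (inj₂ x) (inj₂ y) (inj₁ b) = refl
  colour-sym₂₃ (inj₁ _) (inj₁ _) (inj₂ x) = refl
  colour-sym₂₃ (inj₁ _) (inj₂ x) (inj₁ _) = refl
  colour-sym₂₃ (inj₂ x) (inj₁ _) (inj₁ _) = refl
  colour-sym₂₃ (inj₁ _) (inj₁ _) (inj₁ _) = refl

  col : X → X → X → Fin u
  col x y z = colour (split x) (split y) (split z)

  col-sym₁₂ : ∀ x y z → col x y z ≡ col y x z
  col-sym₁₂ x y z = colour-sym₁₂ (split x) (split y) (split z)

  col-sym₂₃ : ∀ x y z → col x y z ≡ col x z y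
  col-sym₂₃ x y z = colour-sym₂₃ (split x) (split y) (split z)

  col-inf-pt-pt : ∀ b x y → col (inf b) (pt x) (pt y) ≡ w b x y
  col-inf-pt-pt b x y rewrite split-inf {n} b = refl

  -- The third points of {x , y} are parametrised by S itself: in each case the points among
  -- x and y that lie in S are replaced by the missing infinite points.
  record Thirds (x y : X) : Set where
    field
      hue          : Fin n → Fin u
      hue-three    : ThreeToOne hue
      point        : Fin n → X
      point-inj    : ∀ {z z′} → point z ≡ point z′ → z ≡ z′
      point≢₁      : ∀ z → point z ≢ x
      point≢₂      : ∀ z → point z ≢ y
      point-onto   : ∀ p → p ≢ x → p ≢ y → ∃ λ z → point z ≡ p
      col-point    : ∀ z → col x y (point z) ≡ hue z

  thirds-sym : ∀ {x y} → Thirds x y → Thirds y x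
  thirds-sym {x} {y} t = record
    { hue = hue ; hue-three = hue-three ; point = point ; point-inj = point-inj
    ; point≢₁ = point≢₂ ; point≢₂ = point≢₁ ; point-onto = λ p p≢y p≢x → point-onto p p≢x p≢y
    ; col-point = λ z → trans (col-sym₁₂ y x (point z)) (col-point z) }
    where open Thirds t

  thirds-inf-inf : ∀ b → Thirds (inf b) (inf (not b))
  thirds-inf-inf b = record
    { hue = λ z → c z z z ; hue-three = c-cube ; point = pt ; point-inj = pt-injective
    ; point≢₁ = λ z e → inf≢pt b (sym e) ; point≢₂ = λ z e → inf≢pt (not b) (sym e)
    ; point-onto = onto b ; col-point = col-pt }
    where
    onto : ∀ b p → p ≢ inf b → p ≢ inf (not b) → ∃ λ z → pt z ≡ p
    onto false zero          ne _  = contradiction refl ne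
    onto false (suc zero)    _ ne  = contradiction refl ne
    onto true  zero          _ ne  = contradiction refl ne
    onto true  (suc zero)    ne _  = contradiction refl ne
    onto _     (suc (suc z)) _ _   = z , refl
    col-pt : ∀ z → col (inf b) (inf (not b)) (pt z) ≡ c z z z
    col-pt z rewrite split-inf {n} b | split-inf {n} (not b) = refl

  thirds-inf-pt : ∀ b x → Thirds (inf b) (pt x)
  thirds-inf-pt b x = record
    { hue = w b x ; hue-three = w-point b x ; point = point ; point-inj = inj _ _
    ; point≢₁ = ≢₁ ; point≢₂ = ≢₂ ; point-onto = onto ; col-point = col-point }
    where
    point : Fin n → X
    point z with z FinP.≟ x
    ... | yes _ = inf (not b)
    ... | no _  = pt z
    inj : ∀ z z′ → point z ≡ point z′ → z ≡ z′
    inj z z′ e with z FinP.≟ x | z′ FinP.≟ x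
    ... | yes refl | yes refl = refl
    ... | yes _    | no _     = contradiction e (inf≢pt (not b))
    ... | no _     | yes _    = contradiction (sym e) (inf≢pt (not b))
    ... | no _     | no _     = pt-injective e
    ≢₁ : ∀ z → point z ≢ inf b
    ≢₁ z e with z FinP.≟ x
    ... | yes _ = inf-not b (sym e)
    ... | no _  = inf≢pt b (sym e)
    ≢₂ : ∀ z → point z ≢ pt x
    ≢₂ z e with z FinP.≟ x
    ... | yes _  = inf≢pt (not b) e
    ... | no z≢x = z≢x (pt-injective e)
    point-x : point x ≡ inf (not b)
    point-x with x FinP.≟ x
    ... | yes _  = refl
    ... | no x≢x = contradiction refl x≢x
    onto-inf : ∀ b′ → inf {n} b′ ≢ inf b → inf {n} (not b) ≡ inf b′
    onto-inf b′ ne = cong inf (sym (BoolP.¬-not (ne ∘ cong inf)))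
    onto : ∀ p → p ≢ inf b → p ≢ pt x → ∃ λ z → point z ≡ p
    onto zero          ne _ = x , trans point-x (onto-inf false ne)
    onto (suc zero)    ne _ = x , trans point-x (onto-inf true ne)
    onto (suc (suc z)) _ ne = z , lemma
      where
      lemma : point z ≡ pt z
      lemma with z FinP.≟ x
      ... | yes refl = contradiction refl ne
      ... | no _     = refl
    col-point : ∀ z → col (inf b) (pt x) (point z) ≡ w b x z
    col-point z with z FinP.≟ x
    ... | no _     = col-inf-pt-pt b x z
    ... | yes refl rewrite split-inf {n} b | split-inf {n} (not b) = sym (w-diagonal b x)

  -- At `x` and `y` the map `c x y` takes the colours `c x x y` and `c y y x`; `w-choice` tells
  -- which infinite point must stand in which place.
  thirds-pt-pt : ∀ x y → x ≢ y → Thirds (pt x) (pt y)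
  thirds-pt-pt x y x≢y with w-choice x y
  ... | b , wb , wnb = record
    { hue = c x y ; hue-three = c-pair x y ; point = point ; point-inj = inj _ _
    ; point≢₁ = ≢₁ ; point≢₂ = ≢₂ ; point-onto = onto ; col-point = col-point }
    where
    point : Fin n → X
    point z with z FinP.≟ x | z FinP.≟ y
    ... | yes _ | _     = inf b
    ... | no _  | yes _ = inf (not b)
    ... | no _  | no _  = pt z
    inj : ∀ z z′ → point z ≡ point z′ → z ≡ z′
    inj z z′ e with z FinP.≟ x | z FinP.≟ y | z′ FinP.≟ x | z′ FinP.≟ y
    ... | yes refl | _        | yes refl | _        = refl
    ... | yes _    | _        | no _     | yes _    = contradiction e (inf-not b)
    ... | yes _    | _        | no _     | no _     = contradiction e (inf≢pt b)
    ... | no _     | yes _    | yes _    | _        = contradiction (sym e) (inf-not b)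
    ... | no _     | yes refl | no _     | yes refl = refl
    ... | no _     | yes _    | no _     | no _     = contradiction e (inf≢pt (not b))
    ... | no _     | no _     | yes _    | _        = contradiction (sym e) (inf≢pt b)
    ... | no _     | no _     | no _     | yes _    = contradiction (sym e) (inf≢pt (not b))
    ... | no _     | no _     | no _     | no _     = pt-injective e
    ≢₁ : ∀ z → point z ≢ pt x
    ≢₁ z e with z FinP.≟ x | z FinP.≟ y
    ... | yes _  | _     = inf≢pt b e
    ... | no _   | yes _ = inf≢pt (not b) e
    ... | no z≢x | no _  = z≢x (pt-injective e)
    ≢₂ : ∀ z → point z ≢ pt y
    ≢₂ z e with z FinP.≟ x | z FinP.≟ y
    ... | yes _ | _      = inf≢pt b e
    ... | no _  | yes _  = inf≢pt (not b) e
    ... | no _  | no z≢y = z≢y (pt-injective e)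
    point-x : point x ≡ inf b
    point-x with x FinP.≟ x
    ... | yes _  = refl
    ... | no x≢x = contradiction refl x≢x
    point-y : point y ≡ inf (not b)
    point-y with y FinP.≟ x | y FinP.≟ y
    ... | yes y≡x | _      = contradiction (sym y≡x) x≢y
    ... | no _    | yes _  = refl
    ... | no _    | no y≢y = contradiction refl y≢y
    onto-inf : ∀ b′ → ∃ λ z → point z ≡ inf b′
    onto-inf b′ with b′ BoolP.≟ b
    ... | yes b′≡b = x , trans point-x (cong inf (sym b′≡b))
    ... | no b′≢b  = y , trans point-y (cong inf (sym (BoolP.¬-not b′≢b)))
    onto : ∀ p → p ≢ pt x → p ≢ pt y → ∃ λ z → point z ≡ p
    onto zero          _  _   = onto-inf false
    onto (suc zero)    _  _   = onto-inf true
    onto (suc (suc z)) ne ne′ = z , lemma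
      where
      lemma : point z ≡ pt z
      lemma with z FinP.≟ x | z FinP.≟ y
      ... | yes refl | _        = contradiction refl ne
      ... | no _     | yes refl = contradiction refl ne′
      ... | no _     | no _     = refl
    col-point : ∀ z → col (pt x) (pt y) (point z) ≡ c x y z
    col-point z with z FinP.≟ x | z FinP.≟ y
    ... | yes refl | _ rewrite split-inf {n} b       = trans wb (c-sym₂₃ x x y)
    ... | no _ | yes refl rewrite split-inf {n} (not b) =
      trans wnb (trans (c-sym₂₃ y y x) (c-sym₁₂ y x y))
    ... | no _ | no _ = refl

  thirds : ∀ x y → x ≢ y → Thirds x y
  thirds zero          zero          x≢y = contradiction refl x≢y
  thirds zero          (suc zero)    _   = thirds-inf-inf false
  thirds (suc zero)    zero          _   = thirds-inf-inf true
  thirds (suc zero)    (suc zero)    x≢y = contradiction refl x≢y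
  thirds zero          (suc (suc x)) _   = thirds-inf-pt false x
  thirds (suc zero)    (suc (suc x)) _   = thirds-inf-pt true x
  thirds (suc (suc x)) zero          _   = thirds-sym (thirds-inf-pt false x)
  thirds (suc (suc x)) (suc zero)    _   = thirds-sym (thirds-inf-pt true x)
  thirds (suc (suc x)) (suc (suc y)) x≢y = thirds-pt-pt x y (x≢y ∘ cong pt)

  -- Triples of one colour through two points

  Triple : Fin u → Block (2 + n) → Set
  Triple r B = ∃ λ x → ∃ λ y → ∃ λ z → x ≢ y × x ≢ z × y ≢ z × col x y z ≡ r × B ≡ tri x y z

  opaque
    Triple? : ∀ r → Decidable (Triple r)
    Triple? r B = any? λ x → any? λ y → any? λ z →
      ¬? (x FinP.≟ y) ×-dec ¬? (x FinP.≟ z) ×-dec ¬? (y FinP.≟ z) ×-dec (col x y z FinP.≟ r) ×-dec (B ≟B tri x y z)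

  triple-size : ∀ {r B} → Triple r B → ∣ B ∣ ≡ 3
  triple-size (_ , _ , _ , x≢y , x≢z , y≢z , _ , refl) = ∣tri∣ x≢y x≢z y≢z

  -- A `Triple` carries an ordering of its points, on which its colour must not depend; the two
  -- symmetries of `col` generate all six permutations.
  col-permute : ∀ {a b d x y z} → x ≢ y → x ≢ z → y ≢ z →
                x ≡ a ⊎ x ≡ b ⊎ x ≡ d → y ≡ a ⊎ y ≡ b ⊎ y ≡ d → z ≡ a ⊎ z ≡ b ⊎ z ≡ d →
                col x y z ≡ col a b d
  col-permute x≢y x≢z y≢z (inj₁ refl) (inj₂ (inj₁ refl)) (inj₂ (inj₂ refl)) = refl
  col-permute {a} {b} {d} x≢y x≢z y≢z (inj₁ refl) (inj₂ (inj₂ refl)) (inj₂ (inj₁ refl)) = col-sym₂₃ a d b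
  col-permute {a} {b} {d} x≢y x≢z y≢z (inj₂ (inj₁ refl)) (inj₁ refl) (inj₂ (inj₂ refl)) = col-sym₁₂ b a d
  col-permute {a} {b} {d} x≢y x≢z y≢z (inj₂ (inj₁ refl)) (inj₂ (inj₂ refl)) (inj₁ refl) =
    trans (col-sym₂₃ b d a) (col-sym₁₂ b a d)
  col-permute {a} {b} {d} x≢y x≢z y≢z (inj₂ (inj₂ refl)) (inj₁ refl) (inj₂ (inj₁ refl)) =
    trans (col-sym₁₂ d a b) (col-sym₂₃ a d b)
  col-permute {a} {b} {d} x≢y x≢z y≢z (inj₂ (inj₂ refl)) (inj₂ (inj₁ refl)) (inj₁ refl) =
    trans (col-sym₁₂ d b a) (trans (col-sym₂₃ b d a) (col-sym₁₂ b a d))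
  col-permute x≢y _ _ (inj₁ refl) (inj₁ refl) _ = contradiction refl x≢y
  col-permute x≢y _ _ (inj₂ (inj₁ refl)) (inj₂ (inj₁ refl)) _ = contradiction refl x≢y
  col-permute x≢y _ _ (inj₂ (inj₂ refl)) (inj₂ (inj₂ refl)) _ = contradiction refl x≢y
  col-permute _ x≢z _ (inj₁ refl) _ (inj₁ refl) = contradiction refl x≢z
  col-permute _ x≢z _ (inj₂ (inj₁ refl)) _ (inj₂ (inj₁ refl)) = contradiction refl x≢z
  col-permute _ x≢z _ (inj₂ (inj₂ refl)) _ (inj₂ (inj₂ refl)) = contradiction refl x≢z
  col-permute _ _ y≢z _ (inj₁ refl) (inj₁ refl) = contradiction refl y≢z
  col-permute _ _ y≢z _ (inj₂ (inj₁ refl)) (inj₂ (inj₁ refl)) = contradiction refl y≢z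
  col-permute _ _ y≢z _ (inj₂ (inj₂ refl)) (inj₂ (inj₂ refl)) = contradiction refl y≢z

  triple-points : ∀ {r B x y z} → Triple r B → x ∈ B → y ∈ B → z ∈ B → x ≢ y → x ≢ z → y ≢ z →
                  B ≡ tri x y z × col x y z ≡ r
  triple-points t@(a , b , d , a≢b , a≢d , b≢d , colr , refl) x∈ y∈ z∈ x≢y x≢z y≢z =
    sym (⊆∧∣∣≡⇒≡ (tri⊆ x∈ y∈ z∈) (trans (∣tri∣ x≢y x≢z y≢z) (sym (triple-size t)))) ,
    trans (col-permute x≢y x≢z y≢z (∈-tri⁻ x∈) (∈-tri⁻ y∈) (∈-tri⁻ z∈)) colr

  triple-third : ∀ {r B x y} → Triple r B → x ∈ B → y ∈ B → x ≢ y → ∃ λ z → z ∈ B × z ≢ x × z ≢ y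
  triple-third (a , b , d , a≢b , a≢d , b≢d , _ , refl) x∈ y∈ x≢y with ∈-tri⁻ x∈ | ∈-tri⁻ y∈
  ... | inj₁ refl        | inj₁ refl        = contradiction refl x≢y
  ... | inj₁ refl        | inj₂ (inj₁ refl) = d , ∈-tri₃ {x = a} {b} , a≢d ∘ sym , b≢d ∘ sym
  ... | inj₁ refl        | inj₂ (inj₂ refl) = b , ∈-tri₂ {x = a} , a≢b ∘ sym , b≢d
  ... | inj₂ (inj₁ refl) | inj₁ refl        = d , ∈-tri₃ {x = a} {b} , b≢d ∘ sym , a≢d ∘ sym
  ... | inj₂ (inj₁ refl) | inj₂ (inj₁ refl) = contradiction refl x≢y
  ... | inj₂ (inj₁ refl) | inj₂ (inj₂ refl) = a , ∈-tri₁ , a≢b , a≢d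
  ... | inj₂ (inj₂ refl) | inj₁ refl        = b , ∈-tri₂ {x = a} , b≢d , a≢b ∘ sym
  ... | inj₂ (inj₂ refl) | inj₂ (inj₁ refl) = a , ∈-tri₁ , a≢d , a≢b
  ... | inj₂ (inj₂ refl) | inj₂ (inj₂ refl) = contradiction refl x≢y

  module _ {x y : X} (x≢y : x ≢ y) (r : Fin u) where
    open Thirds (thirds x y x≢y)

    triples : List (Block (2 + n))
    triples = map (λ z → tri x y (point z)) (fibre hue-three r)

    triples-unique : Unique triples
    triples-unique = map⁺ (λ {z} {z′} e → point-inj (last-point (∈-tri⁻ (subst (point z ∈_) e (∈-tri₃ {x = x} {y})))))
                       (fibre-unique hue-three r)
      where
      last-point : ∀ {z z′} → point z ≡ x ⊎ point z ≡ y ⊎ point z ≡ point z′ → point z ≡ point z′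
      last-point {z} (inj₁ e)        = contradiction e (point≢₁ z)
      last-point {z} (inj₂ (inj₁ e)) = contradiction e (point≢₂ z)
      last-point     (inj₂ (inj₂ e)) = e

    ∈-triples : ∀ B → B ∈ₗ triples ⇔ (Triple r B × x ∈ B × y ∈ B)
    ∈-triples B = mk⇔ left right
      where
      left : B ∈ₗ triples → Triple r B × x ∈ B × y ∈ B
      left B∈ with z , z∈ , refl ← ∈-map⁻ (λ z → tri x y (point z)) B∈ =
        (x , y , point z , x≢y , point≢₁ z ∘ sym , point≢₂ z ∘ sym ,
          trans (col-point z) (∈-fibre⁻ hue-three r z∈) , refl) , ∈-tri₁ , ∈-tri₂ {x = x}
      right : Triple r B × x ∈ B × y ∈ B → B ∈ₗ triples
      right (t , x∈ , y∈) with p , p∈ , p≢x , p≢y ← triple-third t x∈ y∈ x≢y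
        with z , refl ← point-onto p p≢x p≢y
        with refl , colr ← triple-points t x∈ y∈ p∈ x≢y (p≢x ∘ sym) (p≢y ∘ sym)
        = ∈-map⁺ (λ z → tri x y (point z)) (∈-fibre⁺ hue-three r (trans (sym (col-point z)) colr))

    -- Only blocks through both points are compared, so this also applies after the triples inside
    -- the hole have been removed, if the pair is not inside it.
    pairCount-triples : ∀ {Bs} → Unique Bs → (∀ B → x ∈ B → y ∈ B → B ∈ₗ Bs ⇔ Triple r B) → pairCount x y Bs ≡ 3
    pairCount-triples un same = length-filter-unique (λ C → (x ∈? C) ×-dec (y ∈? C)) un triples-unique λ B →
      mk⇔ (λ B∈ → let (t , x∈ , y∈) = to (∈-triples B) B∈ in from (same B x∈ y∈) t , x∈ , y∈)
          (λ (B∈ , x∈ , y∈) → from (∈-triples B) (to (same B x∈ y∈) B∈ , x∈ , y∈))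

  -- Holes

  group : Fin u → Subset n
  group r = tabulate (λ z → does (c z z z FinP.≟ r))

  hole : Fin u → Block (2 + n)
  hole r = true ∷ true ∷ group r

  inf∈hole : ∀ {r} b → inf b ∈ hole r
  inf∈hole false = here
  inf∈hole true  = there here

  pt∈hole⁺ : ∀ {r z} → c z z z ≡ r → pt z ∈ hole r
  pt∈hole⁺ {r} e = there (there (∈-tabulate⁺ (λ z → c z z z FinP.≟ r) e))

  pt∈hole⁻ : ∀ {r z} → pt z ∈ hole r → c z z z ≡ r
  pt∈hole⁻ {r} (there (there z∈)) = ∈-tabulate⁻ (λ z → c z z z FinP.≟ r) z∈

  ∣hole∣ : ∀ r → ∣ hole r ∣ ≡ 5
  ∣hole∣ r = cong (2 +_) (∣∣-unique (group r) (fibre-unique c-cube r) λ z →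
    mk⇔ (∈-fibre⁺ c-cube r ∘ ∈-tabulate⁻ (λ z → c z z z FinP.≟ r))
        (∈-tabulate⁺ (λ z → c z z z FinP.≟ r) ∘ ∈-fibre⁻ c-cube r))

  hole-injective : ∀ {r s} → hole r ≡ hole s → r ≡ s
  hole-injective {r} {s} e with z , cz≡r , _ ← ranked _ c-cube r zero =
    trans (sym cz≡r) (pt∈hole⁻ (subst (pt z ∈_) e (pt∈hole⁺ cz≡r)))

  InHole : Fin u → Bool ⊎ Fin n → Set
  InHole r (inj₁ _) = ⊤
  InHole r (inj₂ z) = c z z z ≡ r

  ∈hole⁻ : ∀ {r} p → p ∈ hole r → InHole r (split p)
  ∈hole⁻ zero          _  = _
  ∈hole⁻ (suc zero)    _  = _
  ∈hole⁻ (suc (suc z)) p∈ = pt∈hole⁻ p∈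

  ∈hole⁺ : ∀ {r} p → InHole r (split p) → p ∈ hole r
  ∈hole⁺ zero          _ = inf∈hole false
  ∈hole⁺ (suc zero)    _ = inf∈hole true
  ∈hole⁺ (suc (suc z)) e = pt∈hole⁺ e

  colour-hole : ∀ {r} p q s → p ≢ q → p ≢ s → q ≢ s → InHole r p → InHole r q → InHole r s → colour p q s ≡ r
  colour-hole (inj₂ x) (inj₂ y) (inj₂ z) _ _ _ hx hy hz = c-hole′ x y z hx hy hz
  colour-hole (inj₁ b) (inj₂ x) (inj₂ y) _ _ _ _ hx hy  = w-hole b x y hx hy
  colour-hole (inj₂ x) (inj₁ b) (inj₂ y) _ _ _ hx _ hy  = w-hole b x y hx hy
  colour-hole (inj₂ x) (inj₂ y) (inj₁ b) _ _ _ hx hy _  = w-hole b x y hx hy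
  colour-hole (inj₁ _) (inj₁ _) (inj₂ x) _ _ _ _ _ hx   = hx
  colour-hole (inj₁ _) (inj₂ x) (inj₁ _) _ _ _ _ hx _   = hx
  colour-hole (inj₂ x) (inj₁ _) (inj₁ _) _ _ _ hx _ _   = hx
  -- Among three Booleans two coincide.
  colour-hole (inj₁ p) (inj₁ q) (inj₁ s) p≢q p≢s q≢s _ _ _ =
    contradiction (cong inj₁ (trans (BoolP.¬-not (p≢q ∘ cong inj₁)) (sym (BoolP.¬-not (q≢s ∘ cong inj₁ ∘ sym))))) p≢s

  split-≢ : ∀ {p q : X} → p ≢ q → split p ≢ split q
  split-≢ {p} {q} p≢q e = p≢q (trans (sym (join-split p)) (trans (cong join e) (join-split q)))

  col-hole : ∀ {r x y z} → x ≢ y → x ≢ z → y ≢ z → x ∈ hole r → y ∈ hole r → z ∈ hole r → col x y z ≡ r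
  col-hole x≢y x≢z y≢z x∈ y∈ z∈ = colour-hole _ _ _ (split-≢ x≢y) (split-≢ x≢z) (split-≢ y≢z)
    (∈hole⁻ _ x∈) (∈hole⁻ _ y∈) (∈hole⁻ _ z∈)

  -- For two points of the hole, not both infinite, the members of the group already form a full
  -- fibre of colour `r`, so no other third point has that colour. For ∞₁ and ∞₂ that fibre is the
  -- group by definition.
  colour-closed : ∀ {r} p q s → InHole r p → InHole r q → colour p q s ≡ r → InHole r s
  colour-closed p q (inj₁ _) _ _ _ = _
  colour-closed (inj₁ _) (inj₁ _) (inj₂ z) _ _ e = e
  colour-closed {r} (inj₁ b) (inj₂ x) (inj₂ z) _ hx e =
    fibre-⊇ (w-point b x) c-cube r (λ z hz → w-hole b x z hx hz) z e
  colour-closed {r} (inj₂ x) (inj₁ b) (inj₂ z) hx _ e =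
    fibre-⊇ (w-point b x) c-cube r (λ z hz → w-hole b x z hx hz) z e
  colour-closed {r} (inj₂ x) (inj₂ y) (inj₂ z) hx hy e =
    fibre-⊇ (c-pair x y) c-cube r (λ z hz → c-hole′ x y z hx hy hz) z e

  col-closed : ∀ {r} x y z → x ∈ hole r → y ∈ hole r → col x y z ≡ r → z ∈ hole r
  col-closed x y z x∈ y∈ e = ∈hole⁺ z (colour-closed (split x) (split y) (split z) (∈hole⁻ x x∈) (∈hole⁻ y y∈) e)

  out-closed : ∀ {r} x y → c x x x ≡ r → c x x y ≡ r → c y y y ≡ r
  out-closed {r} x y hx = fibre-⊇ (c-pair x x) c-cube r (λ z hz → c-hole′ x x z hx hx hz) y

  in-closed : ∀ {r} x y → c y y y ≡ r → c x x y ≡ r → c x x x ≡ r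
  in-closed {r} x y hy = fibre-⊇ (c-square y) c-cube r (λ z hz → c-hole′ z z y hz hz hy) x

  -- Balance and edges of the digraphs

  module Arcs (r : Fin u) {Arc : Fin n → Fin n → Set} (Arc? : ∀ x y → Dec (Arc x y))
    (tail∉ : ∀ x y → c x x x ≢ r → Arc x y ⇔ c x x y ≡ r)
    (head∉ : ∀ x y → c y y y ≢ r → Arc x y ⇔ c x x y ≡ r)
    (reverse : ∀ x y → c x x x ≡ r → Arc x y → Arc y x)
    (reverse′ : ∀ x y → c y y y ≡ r → Arc x y → Arc y x) where

    -- At a point of the group of colour `r` the arcs come in opposite pairs or not at all; at any
    -- other point both degrees are sizes of fibres, hence three. This covers both large sets, whose
    -- digraphs differ only inside the groups.
    arcs-eulerian : IsEulerian (λ x y → does (Arc? x y))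
    arcs-eulerian x with c x x x FinP.≟ r
    ... | yes hx = cong ∣_∣ (⊆-antisym
            (λ y∈ → ∈-tabulate⁺ (Arc? x) (reverse′ _ x hx (∈-tabulate⁻ (λ y → Arc? y x) y∈)))
            (λ y∈ → ∈-tabulate⁺ (λ y → Arc? y x) (reverse x _ hx (∈-tabulate⁻ (Arc? x) y∈))))
    ... | no hx = trans
            (∣∣-unique _ (fibre-unique (c-square x) r) λ y →
              mk⇔ (∈-fibre⁺ (c-square x) r ∘ to (head∉ y x hx) ∘ ∈-tabulate⁻ (λ y → Arc? y x))
                  (∈-tabulate⁺ (λ y → Arc? y x) ∘ from (head∉ y x hx) ∘ ∈-fibre⁻ (c-square x) r))
            (sym (∣∣-unique _ (fibre-unique (c-pair x x) r) λ y →
              mk⇔ (∈-fibre⁺ (c-pair x x) r ∘ to (tail∉ x y hx) ∘ ∈-tabulate⁻ (Arc? x))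
                  (∈-tabulate⁺ (Arc? x) ∘ from (tail∉ x y hx) ∘ ∈-fibre⁻ (c-pair x x) r)))

  does-⇔ : ∀ {A : Set} (A? : Dec A) → does A? ≡ true ⇔ A
  does-⇔ (yes a) = mk⇔ (λ _ → a) (λ _ → refl)
  does-⇔ (no ¬a) = mk⇔ (λ ()) (λ a → contradiction a ¬a)

  w-arc : ∀ b {r x y} → w b x y ≡ r → c x x y ≡ r ⊎ c y y x ≡ r
  w-arc b {x = x} {y} e with w-arcs x y
  w-arc false e | inj₁ (p , _) = inj₁ (trans (sym p) e)
  w-arc true  e | inj₁ (_ , q) = inj₂ (trans (sym q) e)
  w-arc false e | inj₂ (p , _) = inj₂ (trans (sym p) e)
  w-arc true  e | inj₂ (_ , q) = inj₁ (trans (sym q) e)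

  -- The edge condition of a good design also ranges over equal `x` and `y`; these are ruled out
  -- because `tri` then has only two points.
  triple-inf : ∀ b {r x y} → Triple r (tri (inf b) (pt x) (pt y)) ⇔ (x ≢ y × w b x y ≡ r)
  triple-inf b {r} {x} {y} = mk⇔ left right
    where
    left : Triple r (tri (inf b) (pt x) (pt y)) → x ≢ y × w b x y ≡ r
    left t = x≢y , trans (sym (col-inf-pt-pt b x y)) (proj₂ (triple-points t (∈-tri₁ {x = inf b} {pt x} {pt y})
        (∈-tri₂ {x = inf b} {pt x} {pt y}) (∈-tri₃ {x = inf b} {pt x} {pt y}) (inf≢pt b) (inf≢pt b) (x≢y ∘ pt-injective)))
      where
      x≢y : x ≢ y
      x≢y refl = contradiction (trans (sym (triple-size t)) (∣tri∣-repeated (inf≢pt b {x}))) λ ()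
    right : x ≢ y × w b x y ≡ r → Triple r (tri (inf b) (pt x) (pt y))
    right (x≢y , e) = inf b , pt x , pt y , inf≢pt b , inf≢pt b , x≢y ∘ pt-injective , trans (col-inf-pt-pt b x y) e , refl

  inf-or : ∀ {i : X} → i ≡ ∞₁ ⊎ i ≡ ∞₂ → ∃ λ b → i ≡ inf b
  inf-or (inj₁ e) = false , e
  inf-or (inj₂ e) = true , e

  or-inf : ∀ b → inf {n} b ≡ ∞₁ ⊎ inf {n} b ≡ ∞₂
  or-inf false = inj₁ refl
  or-inf true  = inj₂ refl

  edges : ∀ {Arc : Fin n → Fin n → Set} (Arc? : ∀ x y → Dec (Arc x y)) {Bs : List (Block (2 + n))} x y →
          (Arc x y ⊎ Arc y x → ∃ λ b → tri (inf b) (pt x) (pt y) ∈ₗ Bs) →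
          (∀ b → tri (inf b) (pt x) (pt y) ∈ₗ Bs → Arc x y ⊎ Arc y x) →
          (does (Arc? x y) ≡ true ⊎ does (Arc? y x) ≡ true) ⇔
          (∃ λ i → (i ≡ ∞₁ ⊎ i ≡ ∞₂) × tri i (pt x) (pt y) ∈ₗ Bs)
  edges Arc? x y f g = mk⇔
    (λ e → let (b , b∈) = f (⊎-map (to (does-⇔ (Arc? x y))) (to (does-⇔ (Arc? y x))) e) in inf b , or-inf b , b∈)
    (λ (i , i≡ , i∈) → let (b , e) = inf-or i≡ in
      ⊎-map (from (does-⇔ (Arc? x y))) (from (does-⇔ (Arc? y x))) (g b (subst (λ i → tri i (pt x) (pt y) ∈ₗ _) e i∈)))

  arc-edge : ∀ {r x y} → c x x y ≡ r ⊎ c y y x ≡ r → ∃ λ b → w b x y ≡ r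
  arc-edge {x = x} {y} e with w-choice x y | e
  ... | b , wb , _  | inj₁ p = b , trans wb p
  ... | b , _ , wnb | inj₂ p = not b , trans wnb p

  -- The large set with all blocks of size three

  module Triples where

    triples₃ : Fin u → List (Block (2 + n))
    triples₃ r = filter (Triple? r) (subsets (2 + n))

    ∈-triples₃ : ∀ {r} B → B ∈ₗ triples₃ r ⇔ Triple r B
    ∈-triples₃ {r} B = mk⇔ (proj₂ ∘ ∈-filter⁻ (Triple? r) {xs = subsets (2 + n)})
                           (∈-filter⁺ (Triple? r) (∈-subsets B))

    triples₃-unique : ∀ r → Unique (triples₃ r)
    triples₃-unique r = filter⁺ (Triple? r) (subsets-unique (2 + n))

    Arc : Fin u → Fin n → Fin n → Set
    Arc r x y = c x x y ≡ r × x ≢ y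

    Arc? : ∀ r x y → Dec (Arc r x y)
    Arc? r x y = (c x x y FinP.≟ r) ×-dec ¬? (x FinP.≟ y)

    D : Fin u → GDesign n
    D r = gdesign (triples₃ r) (λ x y → does (Arc? r x y))

    open Family D

    K₃ : ℕ → Set
    K₃ k = k ≡ 3

    size : ∀ r B → B ∈ₗ triples₃ r → ∣ B ∣ ≡ 3
    size r B B∈ = triple-size (to (∈-triples₃ B) B∈)

    pair-design : ∀ r → IsPairDesign 3 (Union3 K₃ Three K₃) (triples₃ r)
    pair-design r = (λ B B∈ → inj₁ (size r B B∈)) ,
      λ x y x≢y → pairCount-triples x≢y r (triples₃-unique r) (λ B _ _ → ∈-triples₃ B)

    size-at : ∀ {k} m → k ≡ 3 → KAt K₃ Three K₃ m k
    size-at zero          e = e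
    size-at (suc zero)    e = e
    size-at (suc (suc _)) e = e

    eulerian : ∀ r → IsEulerian (arcs (D r))
    eulerian r = Arcs.arcs-eulerian r (Arc? r)
      (λ x y hx → mk⇔ proj₁ (λ e → e , λ { refl → hx e }))
      (λ x y hy → mk⇔ proj₁ (λ e → e , λ { refl → hy e }))
      -- Inside the group any two distinct points are joined by arcs in both directions, and an arc
      -- of colour `r` with one end in the group stays in it.
      (λ x y hx (e , x≢y) → c-hole′ y y x (out-closed x y hx e) (out-closed x y hx e) hx , x≢y ∘ sym)
      (λ x y hy (e , x≢y) → c-hole′ y y x hy hy (in-closed x y hy e) , x≢y ∘ sym)

    good : ∀ r → IsGS 3 K₃ K₃ (D r)
    good r = (pair-design r , λ B B∈ → size-at (numInf B) (size r B B∈)) , eulerian r , λ x y →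
      edges (Arc? r) x y
        (λ where
          (inj₁ (e , x≢y)) → let b , we = arc-edge (inj₁ e) in b , from (∈-triples₃ _) (from (triple-inf b) (x≢y , we))
          (inj₂ (e , y≢x)) → let b , we = arc-edge (inj₂ e) in b , from (∈-triples₃ _) (from (triple-inf b) (y≢x ∘ sym , we)))
        (λ b B∈ → let x≢y , we = to (triple-inf b) (to (∈-triples₃ _) B∈) in
          ⊎-map (_, x≢y) (_, x≢y ∘ sym) (w-arc b we))

    large-set : IsLS 3 (Union3 K₃ Three K₃) (map blocks family)
    large-set = ∈-blocks⁻ pair-design , covered , multiplicity
      where
      covered : ∀ x y z → x ≢ y → x ≢ z → y ≢ z → ∃ λ B → (InUnion (map blocks family) B × x ∈ B × y ∈ B × z ∈ B) ×
                (∀ B′ → InUnion (map blocks family) B′ → x ∈ B′ → y ∈ B′ → z ∈ B′ → B′ ≡ B)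
      covered x y z x≢y x≢z y≢z = tri x y z ,
        (∈-union⁺ (col x y z) (from (∈-triples₃ _) (x , y , z , x≢y , x≢z , y≢z , refl , refl)) ,
          ∈-tri₁ , ∈-tri₂ {x = x} , ∈-tri₃ {x = x} {y}) ,
        λ B′ B′∈ x∈ y∈ z∈ → proj₁ (triple-points (to (∈-triples₃ B′) (proj₂ (∈-union⁻ B′∈))) x∈ y∈ z∈ x≢y x≢z y≢z)

      multiplicity : ∀ B → InUnion (map blocks family) B → sum (map (mult B) (map blocks family)) ≡ ∣ B ∣ ∸ 2
      multiplicity B B∈ with r , B∈r ← ∈-union⁻ B∈
        with t@(x , y , z , x≢y , x≢z , y≢z , colr , refl) ← to (∈-triples₃ B) B∈r =
        trans (sum-mult r (mult-∈ (triples₃-unique r) B∈r) λ s s≢r B∈s → s≢r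
                (trans (sym (proj₂ (triple-points (to (∈-triples₃ _) B∈s) ∈-tri₁ (∈-tri₂ {x = x}) (∈-tri₃ {x = x} {y}) x≢y x≢z y≢z))) colr))
              (sym (cong (_∸ 2) (triple-size t)))

    gls : IsGLS 3 K₃ K₃ family
    gls = ∈-family⁻ good , large-set , λ x y x≢y _ → arcCount-family x y (c x x y) λ s →
      mk⇔ (λ a → sym (proj₁ (to (does-⇔ (Arc? s x y)) a)))
          (λ { refl → from (does-⇔ (Arc? s x y)) (refl , x≢y) })

  -- The large set with holes as blocks of size five

  module Quintuples where

    Outside : Fin u → Block (2 + n) → Set
    Outside r B = Triple r B × ¬ (B ⊆ hole r)

    Outside? : ∀ r → Decidable (Outside r)
    Outside? r B = Triple? r B ×-dec ¬? (B ⊆? hole r)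

    outside blocks₅ : Fin u → List (Block (2 + n))
    outside r = filter (Outside? r) (subsets (2 + n))
    blocks₅ r = hole r ∷ hole r ∷ hole r ∷ outside r

    ∈-outside : ∀ {r} B → B ∈ₗ outside r ⇔ Outside r B
    ∈-outside {r} B = mk⇔ (proj₂ ∘ ∈-filter⁻ (Outside? r) {xs = subsets (2 + n)})
                          (∈-filter⁺ (Outside? r) (∈-subsets B))

    outside-unique : ∀ r → Unique (outside r)
    outside-unique r = filter⁺ (Outside? r) (subsets-unique (2 + n))

    ∈-blocks₅⁻ : ∀ {r} B → B ∈ₗ blocks₅ r → B ≡ hole r ⊎ Outside r B
    ∈-blocks₅⁻ B (here e)                  = inj₁ e
    ∈-blocks₅⁻ B (there (here e))          = inj₁ e
    ∈-blocks₅⁻ B (there (there (here e)))  = inj₁ e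
    ∈-blocks₅⁻ B (there (there (there B∈))) = inj₂ (to (∈-outside B) B∈)

    ∈-blocks₅⁺ : ∀ {r} B → Outside r B → B ∈ₗ blocks₅ r
    ∈-blocks₅⁺ B o = there (there (there (from (∈-outside B) o)))

    -- The second condition bars loops and, by `in-closed`, keeps the head as well as the tail out
    -- of the group, whose edges have been absorbed by the hole.
    Arc : Fin u → Fin n → Fin n → Set
    Arc r x y = c x x y ≡ r × c x x x ≢ r

    Arc? : ∀ r x y → Dec (Arc r x y)
    Arc? r x y = (c x x y FinP.≟ r) ×-dec ¬? (c x x x FinP.≟ r)

    D : Fin u → GDesign n
    D r = gdesign (blocks₅ r) (λ x y → does (Arc? r x y))

    open Family D

    K₃ K₅ K : ℕ → Set
    K₃ k = k ≡ 3
    K₅ k = k ≡ 5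
    K = Union3 K₃ Three K₅

    module _ {P : Pred (Block (2 + n)) 0ℓ} (P? : Decidable P) (r : Fin u) where

      count-accept : P (hole r) → length (filter P? (blocks₅ r)) ≡ 3 + length (filter P? (outside r))
      count-accept p = cong length (trans (filter-accept P? p) (cong (hole r ∷_)
        (trans (filter-accept P? p) (cong (hole r ∷_) (filter-accept P? p)))))

      count-reject : ¬ P (hole r) → length (filter P? (blocks₅ r)) ≡ length (filter P? (outside r))
      count-reject ¬p = cong length (trans (filter-reject P? ¬p) (trans (filter-reject P? ¬p) (filter-reject P? ¬p)))

    -- A pair inside the hole lies in its three copies and, by `col-closed`, in no remaining triple.
    -- Through any other pair no triple has been removed.
    pairs : ∀ r x y → x ≢ y → pairCount x y (blocks₅ r) ≡ 3
    pairs r x y x≢y with (x ∈? hole r) ×-dec (y ∈? hole r)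
    ... | yes (x∈ , y∈) = trans (count-accept both? r (x∈ , y∈))
                                (cong (λ l → 3 + length l) (filter-none both? (All.tabulate misses)))
      where
      both? = λ (C : Block (2 + n)) → (x ∈? C) ×-dec (y ∈? C)
      misses : ∀ {B} → B ∈ₗ outside r → ¬ (x ∈ B × y ∈ B)
      misses {B} B∈ (x∈B , y∈B)
        with t , B⊈ ← to (∈-outside B) B∈
        with z , z∈B , z≢x , z≢y ← triple-third t x∈B y∈B x≢y
        with refl , colr ← triple-points t x∈B y∈B z∈B x≢y (z≢x ∘ sym) (z≢y ∘ sym) =
        B⊈ (tri⊆ x∈ y∈ (col-closed x y z x∈ y∈ colr))
    ... | no ¬both = trans (count-reject (λ C → (x ∈? C) ×-dec (y ∈? C)) r ¬both)
      (pairCount-triples x≢y r (outside-unique r) λ B x∈ y∈ →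
        mk⇔ (proj₁ ∘ to (∈-outside B))
            (λ t → from (∈-outside B) (t , λ B⊆ → ¬both (B⊆ x∈ , B⊆ y∈))))

    pair-design : ∀ r → IsPairDesign 3 K (blocks₅ r)
    pair-design r = size , pairs r
      where
      size : ∀ B → B ∈ₗ blocks₅ r → K ∣ B ∣
      size B B∈ with ∈-blocks₅⁻ B B∈
      ... | inj₁ refl    = inj₂ (inj₂ (∣hole∣ r))
      ... | inj₂ (t , _) = inj₁ (triple-size t)

    size-at : (B : Block (2 + n)) → ∣ B ∣ ≡ 3 → ¬ (∞₁ ∈ B × ∞₂ ∈ B) → KAt K₃ Three K₅ (numInf B) ∣ B ∣
    size-at (true  ∷ true  ∷ p) e no-both = contradiction (here , there here) no-both
    size-at (true  ∷ false ∷ p) e no-both = e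
    size-at (false ∷ true  ∷ p) e no-both = e
    size-at (false ∷ false ∷ p) e no-both = e

    -- A triple of colour `r` through ∞₁ and ∞₂ lies in the hole and has been removed, so only the
    -- hole contains both.
    sizes : ∀ r B → B ∈ₗ blocks₅ r → KAt K₃ Three K₅ (numInf B) ∣ B ∣
    sizes r B B∈ with ∈-blocks₅⁻ B B∈
    ... | inj₁ refl     = ∣hole∣ r
    ... | inj₂ (t , B⊈) = size-at B (triple-size t) λ (∞₁∈ , ∞₂∈) →
      let z , z∈ , z≢₁ , z≢₂ = triple-third t ∞₁∈ ∞₂∈ (λ ())
          B≡ , colr = triple-points t ∞₁∈ ∞₂∈ z∈ (λ ()) (z≢₁ ∘ sym) (z≢₂ ∘ sym)
      in B⊈ (subst (_⊆ hole r) (sym B≡) (tri⊆ (inf∈hole false) (inf∈hole true)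
           (col-closed ∞₁ ∞₂ z (inf∈hole false) (inf∈hole true) colr)))

    eulerian : ∀ r → IsEulerian (arcs (D r))
    eulerian r = Arcs.arcs-eulerian r (Arc? r)
      (λ x y hx → mk⇔ proj₁ (_, hx))
      (λ x y hy → mk⇔ proj₁ (λ e → e , λ hx → hy (out-closed x y hx e)))
      (λ x y hx (_ , ¬hx) → contradiction hx ¬hx)
      (λ x y hy (e , ¬hx) → contradiction (in-closed x y hy e) ¬hx)

    good : ∀ r → IsGS 3 K₃ K₅ (D r)
    good r = (pair-design r , sizes r) , eulerian r , λ x y → edges (Arc? r) x y (arc→block x y) (block→arc x y)
      where
      arc→block : ∀ x y → Arc r x y ⊎ Arc r y x → ∃ λ b → tri (inf b) (pt x) (pt y) ∈ₗ blocks₅ r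
      arc→block x y (inj₁ (e , ¬hx)) = let b , we = arc-edge (inj₁ e) in
        b , ∈-blocks₅⁺ _ (from (triple-inf b) ((λ { refl → ¬hx e }) , we) ,
          λ B⊆ → ¬hx (pt∈hole⁻ (B⊆ (∈-tri₂ {x = inf b} {pt x} {pt y}))))
      arc→block x y (inj₂ (e , ¬hy)) = let b , we = arc-edge (inj₂ e) in
        b , ∈-blocks₅⁺ _ (from (triple-inf b) ((λ { refl → ¬hy e }) , we) ,
          λ B⊆ → ¬hy (pt∈hole⁻ (B⊆ (∈-tri₃ {x = inf b} {pt x} {pt y}))))

      other∉ : ∀ b x y → inf (not b) ∈ tri (inf b) (pt x) (pt y) → ⊥
      other∉ b x y ∈t with ∈-tri⁻ ∈t
      ... | inj₁ e        = inf-not b (sym e)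
      ... | inj₂ (inj₁ e) = inf≢pt (not b) e
      ... | inj₂ (inj₂ e) = inf≢pt (not b) e

      block→arc : ∀ x y b → tri (inf b) (pt x) (pt y) ∈ₗ blocks₅ r → Arc r x y ⊎ Arc r y x
      block→arc x y b B∈ with ∈-blocks₅⁻ _ B∈
      -- The hole contains both infinite points, the triple only one.
      ... | inj₁ e = contradiction (subst (inf (not b) ∈_) (sym e) (inf∈hole (not b))) (other∉ b x y)
      ... | inj₂ (t , B⊈) with w-arc b (proj₂ (to (triple-inf b) t))
      ... | inj₁ e = inj₁ (e , λ hx → B⊈ (tri⊆ (inf∈hole b) (pt∈hole⁺ hx) (pt∈hole⁺ (out-closed x y hx e))))
      ... | inj₂ e = inj₂ (e , λ hy → B⊈ (tri⊆ (inf∈hole b) (pt∈hole⁺ (out-closed y x hy e)) (pt∈hole⁺ hy)))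

    hole∉outside : ∀ r s → ¬ Outside s (hole r)
    hole∉outside r s (t , _) = contradiction (trans (sym (∣hole∣ r)) (triple-size t)) λ ()

    hole-mult : ∀ r → mult (hole r) (blocks₅ r) ≡ 3
    hole-mult r = trans (count-accept (λ C → C ≟B hole r) r refl)
      (cong (3 +_) (mult-∉ (hole∉outside r r ∘ to (∈-outside (hole r)))))

    large-set : IsLS 3 K (map blocks family)
    large-set = ∈-blocks⁻ pair-design , covered , multiplicity
      where
      covered : ∀ x y z → x ≢ y → x ≢ z → y ≢ z → ∃ λ B → (InUnion (map blocks family) B × x ∈ B × y ∈ B × z ∈ B) ×
                (∀ B′ → InUnion (map blocks family) B′ → x ∈ B′ → y ∈ B′ → z ∈ B′ → B′ ≡ B)
      covered x y z x≢y x≢z y≢z with tri x y z ⊆? hole (col x y z)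
      ... | yes inside = hole r , (∈-union⁺ r (here refl) ,
              inside ∈-tri₁ , inside (∈-tri₂ {x = x}) , inside (∈-tri₃ {x = x} {y})) , unique
        where
        r = col x y z
        unique : ∀ B′ → InUnion (map blocks family) B′ → x ∈ B′ → y ∈ B′ → z ∈ B′ → B′ ≡ hole r
        unique B′ B′∈ x∈ y∈ z∈ with s , B′∈s ← ∈-union⁻ B′∈ with ∈-blocks₅⁻ B′ B′∈s
        -- Every triple inside a hole has the colour of that hole, so two holes cannot share three
        -- points.
        ... | inj₁ refl = cong hole (sym (col-hole x≢y x≢z y≢z x∈ y∈ z∈))
        ... | inj₂ (t , B′⊈) with refl , refl ← triple-points t x∈ y∈ z∈ x≢y x≢z y≢z = ⊥-elim (B′⊈ inside)
      ... | no ¬inside = tri x y z , (∈-union⁺ r (∈-blocks₅⁺ _ ((x , y , z , x≢y , x≢z , y≢z , refl , refl) , ¬inside)) ,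
              ∈-tri₁ , ∈-tri₂ {x = x} , ∈-tri₃ {x = x} {y}) , unique
        where
        r = col x y z
        unique : ∀ B′ → InUnion (map blocks family) B′ → x ∈ B′ → y ∈ B′ → z ∈ B′ → B′ ≡ tri x y z
        unique B′ B′∈ x∈ y∈ z∈ with s , B′∈s ← ∈-union⁻ B′∈ with ∈-blocks₅⁻ B′ B′∈s
        ... | inj₁ refl with refl ← col-hole x≢y x≢z y≢z x∈ y∈ z∈ = ⊥-elim (¬inside (tri⊆ x∈ y∈ z∈))
        ... | inj₂ (t , _) = proj₁ (triple-points t x∈ y∈ z∈ x≢y x≢z y≢z)

      multiplicity : ∀ B → InUnion (map blocks family) B → sum (map (mult B) (map blocks family)) ≡ ∣ B ∣ ∸ 2
      multiplicity B B∈ with r , B∈r ← ∈-union⁻ B∈ with ∈-blocks₅⁻ B B∈r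
      ... | inj₁ refl = trans (sum-mult r (hole-mult r) elsewhere) (sym (cong (_∸ 2) (∣hole∣ r)))
        where
        elsewhere : ∀ s → s ≢ r → hole r ∉ₗ blocks₅ s
        elsewhere s s≢r h∈ with ∈-blocks₅⁻ (hole r) h∈
        ... | inj₁ e = s≢r (hole-injective (sym e))
        ... | inj₂ o = hole∉outside r s o
      ... | inj₂ o@(t@(x , y , z , x≢y , x≢z , y≢z , colr , refl) , _) =
        trans (sum-mult r once elsewhere) (sym (cong (_∸ 2) (triple-size t)))
        where
        not-hole : ∀ s → hole s ≢ tri x y z
        not-hole s e = contradiction (trans (sym (∣hole∣ s)) (trans (cong ∣_∣ e) (triple-size t))) λ ()
        once : mult (tri x y z) (blocks₅ r) ≡ 1
        once = trans (count-reject (λ C → C ≟B tri x y z) r (not-hole r))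
                     (mult-∈ (outside-unique r) (from (∈-outside (tri x y z)) o))
        elsewhere : ∀ s → s ≢ r → tri x y z ∉ₗ blocks₅ s
        elsewhere s s≢r B∈s with ∈-blocks₅⁻ (tri x y z) B∈s
        ... | inj₁ e = not-hole s (sym e)
        ... | inj₂ (t′ , _) = s≢r (trans (sym (proj₂ (triple-points t′ ∈-tri₁ (∈-tri₂ {x = x}) (∈-tri₃ {x = x} {y}) x≢y x≢z y≢z))) colr)

    repeated : ∀ r B → B ∈ₗ blocks₅ r → 4 ≤ ∣ B ∣ → mult B (blocks₅ r) ≡ 3
    repeated r B B∈ 4≤ with ∈-blocks₅⁻ B B∈
    ... | inj₁ refl    = hole-mult r
    ... | inj₂ (t , _) = contradiction (subst (4 ≤_) (triple-size t) 4≤) λ { (s≤s (s≤s (s≤s ()))) }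

    gls* : IsGLS* 3 K₃ K₅ family
    gls* = (∈-family⁻ good , large-set , single-arc) , (large-set , ∈-blocks⁻ repeated)
      where
      single-arc : ∀ x y → x ≢ y →
        (∀ B → InUnion (map blocks family) B → ∞₁ ∈ B → ∞₂ ∈ B → pt x ∈ B → pt y ∈ B → ⊥) →
        arcCount family x y ≡ 1
      single-arc x y x≢y apart = arcCount-family x y (c x x y) λ s →
        mk⇔ (λ a → sym (proj₁ (to (does-⇔ (Arc? s x y)) a)))
            -- If the tail were in the group of the arc's colour, so would be the head, and both
            -- would share a block with ∞₁ and ∞₂.
            (λ { refl → from (does-⇔ (Arc? s x y)) (refl , λ hx →
              apart (hole s) (∈-union⁺ s (here refl)) (inf∈hole false) (inf∈hole true)
                (pt∈hole⁺ hx) (pt∈hole⁺ (out-closed x y hx refl))) })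

-- Existence of colourings

-- A common divisor is odd, so 24 can be halved three times; what is left divides the prime 3.
coprime-24 : ∀ {u} → Coprime u 2 → ¬ (3 ∣ u) → Coprime u 24
coprime-24 {u} odd 3∤u {d} (d∣u , d∣24) with prime⇒irreducible (from-yes (prime? 3)) (halve 3 (halve 6 (halve 12 d∣24)))
  where
  halve : ∀ k → d ∣ 2 * k → d ∣ k
  halve k = coprime-divisor λ (e∣d , e∣2) → odd (∣-trans e∣d d∣u , e∣2)
... | inj₁ d≡1  = d≡1
... | inj₂ refl = contradiction d∣u 3∤u

colouring : ∀ u → Acc _<_ u → .{{_ : NonZero u}} → Coprime u 2 → Colouring (Fin u × Fin 3) (Fin u)
colouring u (acc smaller) odd with 3 ∣? u
... | no 3∤u = Affine.affine u (coprime-24 odd 3∤u)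
... | yes (divides q@(suc _) refl) =
  colouring-map (×-map₁ (remQuot 3)) (λ {x} {y} → unpack-injective x y)
                (uncurry combine) (λ {i} {j} → pack-injective i j)
    (Tripling.tripled q odd-q (colouring q (smaller (ℕP.m<m*n q 3 (s≤s (s≤s z≤n)))) odd-q))
  where
  odd-q : Coprime q 2
  odd-q (d∣q , d∣2) = odd (∣-trans d∣q (m∣m*n 3) , d∣2)
  unpack-injective : ∀ (x y : Fin (q * 3) × Fin 3) → ×-map₁ (remQuot 3) x ≡ ×-map₁ (remQuot 3) y → x ≡ y
  unpack-injective (x , i) (y , j) e = cong₂ _,_
    (trans (sym (FinP.combine-remQuot {q} 3 x))
      (trans (cong (uncurry combine ∘ proj₁) e) (FinP.combine-remQuot {q} 3 y)))
    (cong proj₂ e)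
  pack-injective : ∀ (i j : Fin q × Fin 3) → uncurry combine i ≡ uncurry combine j → i ≡ j
  pack-injective (i , a) (j , b) e =
    cong₂ _,_ (FinP.combine-injectiveˡ i a j b e) (FinP.combine-injectiveʳ i a j b e)

coprime-2 : ∀ u → u % 6 ≡ 1 ⊎ u % 6 ≡ 3 → Coprime u 2
coprime-2 u residue {d} (d∣u , d∣2) with prime⇒irreducible (from-yes (prime? 2)) d∣2
... | inj₁ d≡1  = d≡1
-- As 2 divides 6, an even `u` would have an even residue.
... | inj₂ refl with residue | %-presˡ-∣ d∣u (divides 3 refl)
... | inj₁ e | 2∣r = contradiction (subst (2 ∣_) e 2∣r) (from-no (2 ∣? 1))
... | inj₂ e | 2∣r = contradiction (subst (2 ∣_) e 2∣r) (from-no (2 ∣? 3))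

theorem3p8 : ∀ (u : ℕ) → 0 < u → (u % 6 ≡ 1 ⊎ u % 6 ≡ 3) →
    (∃ λ (ds : List (GDesign (3 * u))) →
    IsGLS* 3 (λ k → k ≡ 3) (λ k → k ≡ 5) ds) ×
    (∃ λ (ds : List (GDesign (3 * u))) →
    IsGLS 3 (λ k → k ≡ 3) (λ k → k ≡ 3) ds)
theorem3p8 u 0<u residue = (_ , Quintuples.gls*) , (_ , Triples.gls)
  where
  instance
    u≢0 : NonZero u
    u≢0 = >-nonZero 0<u
  point : Fin (3 * u) → Fin u × Fin 3
  -- `remQuot` on `3 * u` returns the level before the coordinate in `Fin u`.
  point x = swap (remQuot {3} u x)
  point-injective : ∀ {x y} → point x ≡ point y → x ≡ y
  point-injective {x} {y} e = trans (sym (FinP.combine-remQuot {3} u x))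
    (trans (cong (uncurry combine ∘ swap) e) (FinP.combine-remQuot {3} u y))
  open Designs (ℕP.*-comm 3 u)
    (colouring-map point point-injective (λ i → i) (λ e → e) (colouring u (<-wellFounded u) (coprime-2 u residue)))
    (fromℕ< 0<u)
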